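{- The variety $\mathcal{V}$ of all double-Heyting algebras is not coherent, does not admit right uniform deductive interpolation, and its first-order theory does not have a model completion.
   Context: A double-Heyting algebra is an algebra $\langle A,\wedge,\vee,\to,-,0,1\rangle$ such that $\langle A,\wedge,\vee,\to,0,1\rangle$ is a Heyting algebra and $\langle A,\vee,\wedge,-,0,1\rangle$ is a dual Heyting algebra, with $-$ dually residuating $\vee$: $x-y\le z\iff x\le y\vee z$. A variety $\mathcal{V}$ is coherent if every finitely generated subalgebra of a finitely presented member of $\mathcal{V}$ is finitely presented (finitely presented: isomorphic to a quotient of a finitely generated free algebra of $\mathcal{V}$ by a finitely generated congruence). $\Sigma\models_{\mathcal{V}}\varepsilon$ means that every assignment of the variables into any member of $\mathcal{V}$ satisfying all equations in $\Sigma$ satisfies $\varepsilon$. $\mathcal{V}$ admits right uniform deductive interpolation if for any finite disjoint sets of variables $\overline{x},\overline{y}$ and finite set $\Sigma$ of equations in variables $\overline{x},\overline{y}$, there is a finite set $\Pi$ of equations in variables $\overline{y}$ such that for every equation $\varepsilon$ whose variables lie in $\overline{y}$ and a set $\overline{z}$ disjoint from $\overline{x},\overline{y}$: $\Sigma\models_{\mathcal{V}}\varepsilon\iff\Pi\models_{\mathcal{V}}\varepsilon$. A model completion of a theory $T$ is a theory $T^*\supseteq T$ in the same language such that every model of $T$ embeds into a model of $T^*$ and, for every model $M$ of $T$, $T^*$ together with the quantifier-free diagram of $M$ is a complete theory. -}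

module Defs where

open import Algebra.Core using (Op₂)
open import Algebra.Definitions using (Congruent₂)
import Algebra.Lattice.Bundles as Lat
import Algebra.Lattice.Properties.Lattice as LatticeProperties
open import Data.Empty using (⊥; ⊥-elim)
open import Data.Fin.Base using (Fin; zero; suc)
open import Data.List.Base using (List; []; _∷_; map)
open import Data.List.Membership.Propositional using () renaming (_∈_ to _∈ˡ_)
open import Data.List.Relation.Unary.All using (All)
open import Data.Nat.Base using (ℕ; zero; suc)
open import Data.Product.Base using (Σ; ∃; Σ-syntax; ∃-syntax; _×_; _,_; proj₁; proj₂)
open import Data.Sum.Base as Sum using (_⊎_; inj₁; inj₂; [_,_]′)
import Data.Vec.Functional as Vector
open import Function.Base using (flip; _∘_; id)
open import Function.Bundles using (_⇔_)
open import Function.Definitions using (Congruent; Injective; Surjective)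
open import Level using (Level; _⊔_; 0ℓ) renaming (suc to lsuc)
open import Relation.Binary.Core using (Rel)
open import Relation.Binary.Structures using (IsEquivalence)
open import Relation.Binary.Lattice.Structures using (IsHeytingAlgebra)
import Relation.Binary.Construct.NaturalOrder.Left as NaturalOrder
open import Relation.Binary.PropositionalEquality.Core using (_≡_)
open import Relation.Nullary.Negation.Core using (¬_)
open import Relation.Unary using (Pred; _∈_; _⊆_; _∪_)

private
  variable
    a b c d ℓ ℓ′ p : Level
    C : Set c
    n m : ℕ

record Algebra (c ℓ : Level) : Set (lsuc (c ⊔ ℓ)) where
  infix  4 _≈_
  infixr 7 _∧_
  infixr 6 _∨_
  infixr 5 _⇨_
  infixl 5 _-_
  field
    Carrier             : Set c
    _≈_                 : Rel Carrier ℓ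
    _∧_ _∨_ _⇨_ _-_     : Op₂ Carrier
    𝟘 𝟙                 : Carrier
    isEquivalence       : IsEquivalence _≈_
    ∧-cong              : Congruent₂ _≈_ _∧_
    ∨-cong              : Congruent₂ _≈_ _∨_
    ⇨-cong              : Congruent₂ _≈_ _⇨_
    -‿cong              : Congruent₂ _≈_ _-_

  -- x ≤ y unfolds to x ≈ x ∧ y.
  open NaturalOrder _≈_ _∧_ public using (_≤_)

-- The second field is the Heyting algebra axiom for the opposite order:
-- its exponential law reads  y - x ≤ w  iff  y ≤ w ∨ x.
record IsDoubleHeytingAlgebra (A : Algebra c ℓ) : Set (c ⊔ ℓ) where
  open Algebra A
  field
    isHeytingAlgebra     : IsHeytingAlgebra _≈_ _≤_ _∨_ _∧_ _⇨_ 𝟙 𝟘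
    isDualHeytingAlgebra : IsHeytingAlgebra _≈_ (flip _≤_) _∧_ _∨_ (flip _-_) 𝟘 𝟙

record IsHomomorphism (A : Algebra a ℓ) (B : Algebra b ℓ′)
                      (h : Algebra.Carrier A → Algebra.Carrier B) :
                      Set (a ⊔ ℓ ⊔ ℓ′) where
  private
    module A = Algebra A
    module B = Algebra B
  field
    cong   : Congruent A._≈_ B._≈_ h
    ∧-homo : ∀ x y → h (x A.∧ y) B.≈ h x B.∧ h y
    ∨-homo : ∀ x y → h (x A.∨ y) B.≈ h x B.∨ h y
    ⇨-homo : ∀ x y → h (x A.⇨ y) B.≈ h x B.⇨ h y
    -‿homo : ∀ x y → h (x A.- y) B.≈ h x B.- h y
    𝟘-homo : h A.𝟘 B.≈ B.𝟘
    𝟙-homo : h A.𝟙 B.≈ B.𝟙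

Embeds : Algebra a ℓ → Algebra b ℓ′ → Set (a ⊔ ℓ ⊔ b ⊔ ℓ′)
Embeds A B = ∃[ h ] IsHomomorphism A B h × Injective (Algebra._≈_ A) (Algebra._≈_ B) h

_≅_ : Algebra a ℓ → Algebra b ℓ′ → Set (a ⊔ ℓ ⊔ b ⊔ ℓ′)
A ≅ B = ∃[ h ] IsHomomorphism A B h
             × Injective  (Algebra._≈_ A) (Algebra._≈_ B) h
             × Surjective (Algebra._≈_ A) (Algebra._≈_ B) h

infixr 7 _∧ᵗ_
infixr 6 _∨ᵗ_
infixr 5 _⇨ᵗ_
infixl 5 _-ᵗ_

data Term (X : Set a) : Set a where
  var                       : X → Term X
  _∧ᵗ_ _∨ᵗ_ _⇨ᵗ_ _-ᵗ_       : Op₂ (Term X)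
  𝟘ᵗ 𝟙ᵗ                     : Term X

module _ {X : Set a} {Y : Set b} (σ : X → Term Y) where
  bind : Term X → Term Y
  bind (var x)  = σ x
  bind (s ∧ᵗ t) = bind s ∧ᵗ bind t
  bind (s ∨ᵗ t) = bind s ∨ᵗ bind t
  bind (s ⇨ᵗ t) = bind s ⇨ᵗ bind t
  bind (s -ᵗ t) = bind s -ᵗ bind t
  bind 𝟘ᵗ       = 𝟘ᵗ
  bind 𝟙ᵗ       = 𝟙ᵗ

rename : {X : Set a} {Y : Set b} → (X → Y) → Term X → Term Y
rename f = bind (var ∘ f)

module _ (A : Algebra c ℓ) {X : Set a} (ρ : X → Algebra.Carrier A) where
  open Algebra A

  eval : Term X → Carrier
  eval (var x)  = ρ x
  eval (s ∧ᵗ t) = eval s ∧ eval t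
  eval (s ∨ᵗ t) = eval s ∨ eval t
  eval (s ⇨ᵗ t) = eval s ⇨ eval t
  eval (s -ᵗ t) = eval s - eval t
  eval 𝟘ᵗ       = 𝟘
  eval 𝟙ᵗ       = 𝟙

Equation : Set a → Set a
Equation X = Term X × Term X

renameEq : {X : Set a} {Y : Set b} → (X → Y) → Equation X → Equation Y
renameEq f (s , t) = rename f s , rename f t

Holds : (A : Algebra c ℓ) {X : Set a} → (X → Algebra.Carrier A) → Equation X → Set ℓ
Holds A ρ (s , t) = eval A ρ s ≈ eval A ρ t
  where open Algebra A

-- Terms modulo the least congruence whose quotient is a double-Heyting
-- algebra; s ≲ t is the natural order of that quotient.
module _ {X : Set a} where

  infix 4 _≃_ _≲_

  data _≃_ : Rel (Term X) a
  _≲_ : Rel (Term X) a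
  s ≲ t = s ≃ s ∧ᵗ t

  data _≃_ where
    ≃-refl    : ∀ {s} → s ≃ s
    ≃-sym     : ∀ {s t} → s ≃ t → t ≃ s
    ≃-trans   : ∀ {s t u} → s ≃ t → t ≃ u → s ≃ u
    ∧ᵗ-cong   : Congruent₂ _≃_ _∧ᵗ_
    ∨ᵗ-cong   : Congruent₂ _≃_ _∨ᵗ_
    ⇨ᵗ-cong   : Congruent₂ _≃_ _⇨ᵗ_
    -ᵗ-cong   : Congruent₂ _≃_ _-ᵗ_
    ∧ᵗ-comm   : ∀ s t → s ∧ᵗ t ≃ t ∧ᵗ s
    ∨ᵗ-comm   : ∀ s t → s ∨ᵗ t ≃ t ∨ᵗ s
    ∧ᵗ-assoc  : ∀ s t u → (s ∧ᵗ t) ∧ᵗ u ≃ s ∧ᵗ (t ∧ᵗ u)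
    ∨ᵗ-assoc  : ∀ s t u → (s ∨ᵗ t) ∨ᵗ u ≃ s ∨ᵗ (t ∨ᵗ u)
    ∨-absorbs : ∀ s t → s ∨ᵗ (s ∧ᵗ t) ≃ s
    ∧-absorbs : ∀ s t → s ∧ᵗ (s ∨ᵗ t) ≃ s
    𝟘-least   : ∀ s → 𝟘ᵗ ≲ s
    𝟙-most    : ∀ s → s ≲ 𝟙ᵗ
    ⇨-intro   : ∀ s t u → s ∧ᵗ t ≲ u → s ≲ t ⇨ᵗ u
    ⇨-elim    : ∀ s t u → s ≲ t ⇨ᵗ u → s ∧ᵗ t ≲ u
    -‿intro   : ∀ s t u → s ≲ t ∨ᵗ u → s -ᵗ t ≲ u
    -‿elim    : ∀ s t u → s -ᵗ t ≲ u → s ≲ t ∨ᵗ u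

Free : Set a → Algebra a a
Free X = record
  { Carrier = Term X ; _≈_ = _≃_
  ; _∧_ = _∧ᵗ_ ; _∨_ = _∨ᵗ_ ; _⇨_ = _⇨ᵗ_ ; _-_ = _-ᵗ_ ; 𝟘 = 𝟘ᵗ ; 𝟙 = 𝟙ᵗ
  ; isEquivalence = record { refl = ≃-refl ; sym = ≃-sym ; trans = ≃-trans }
  ; ∧-cong = ∧ᵗ-cong ; ∨-cong = ∨ᵗ-cong ; ⇨-cong = ⇨ᵗ-cong ; -‿cong = -ᵗ-cong
  }

Free-isDoubleHeytingAlgebra : (X : Set a) → IsDoubleHeytingAlgebra (Free X)
Free-isDoubleHeytingAlgebra X = record
  { isHeytingAlgebra = record
    { isBoundedLattice = record
      { isLattice = ∨-∧-isOrderTheoreticLattice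
      ; maximum   = 𝟙-most
      ; minimum   = 𝟘-least
      }
    ; exponential = λ w x y → ⇨-intro w x y , ⇨-elim w x y
    }
  ; isDualHeytingAlgebra = record
    { isBoundedLattice = record
      { isLattice = ∧-∨-isOrderTheoreticLattice
      ; maximum   = 𝟘-least
      ; minimum   = 𝟙-most
      }
    ; exponential = λ w x y →
        (λ y≲w∨x → -‿intro y x w (≃-trans y≲w∨x (∧ᵗ-cong ≃-refl (∨ᵗ-comm w x))))
      , (λ y-x≲w → ≃-trans (-‿elim y x w y-x≲w) (∧ᵗ-cong ≃-refl (∨ᵗ-comm x w)))
    }
  }
  where
  lattice : Lat.Lattice _ _
  lattice = record
    { isLattice = record
      { isEquivalence = Algebra.isEquivalence (Free X)
      ; ∨-comm = ∨ᵗ-comm ; ∨-assoc = ∨ᵗ-assoc ; ∨-cong = ∨ᵗ-cong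
      ; ∧-comm = ∧ᵗ-comm ; ∧-assoc = ∧ᵗ-assoc ; ∧-cong = ∧ᵗ-cong
      ; absorptive = ∨-absorbs , ∧-absorbs
      }
    }
  open LatticeProperties lattice using (∨-∧-isOrderTheoreticLattice)
  open import Relation.Binary.Lattice.Structures (_≃_ {X = X}) (flip _≲_)
    using () renaming (IsLattice to IsLatticeᵒᵖ)
  open import Relation.Binary.Lattice.Structures (_≃_ {X = X}) _≲_
    using (module IsLattice)
  open import Relation.Binary.Construct.Flip.EqAndOrd using (isPartialOrder)

  ∧-∨-isOrderTheoreticLattice : IsLatticeᵒᵖ _∧ᵗ_ _∨ᵗ_
  ∧-∨-isOrderTheoreticLattice = record
    { isPartialOrder = record
      { isPreorder = record
        { isEquivalence = Algebra.isEquivalence (Free X)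
        ; reflexive     = λ s≃t → reflexive (≃-sym s≃t)
        ; trans         = flip trans
        }
      ; antisym = flip antisym
      }
    ; supremum = infimum
    ; infimum  = supremum
    }
    where open IsLattice ∨-∧-isOrderTheoreticLattice

-- The universal property, for the extension `eval A ρ` of ρ.
eval-isHomomorphism : (A : Algebra c ℓ) → IsDoubleHeytingAlgebra A →
                      {X : Set a} (ρ : X → Algebra.Carrier A) →
                      IsHomomorphism (Free X) A (eval A ρ)
eval-isHomomorphism A dha {X} ρ = record
  { cong = sound
  ; ∧-homo = λ _ _ → refl ; ∨-homo = λ _ _ → refl
  ; ⇨-homo = λ _ _ → refl ; -‿homo = λ _ _ → refl
  ; 𝟘-homo = refl ; 𝟙-homo = refl
  }
  where
  open Algebra A
  open IsEquivalence isEquivalence using (refl; sym; trans)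
  open IsDoubleHeytingAlgebra dha
  module H = IsHeytingAlgebra isHeytingAlgebra
  module D = IsHeytingAlgebra isDualHeytingAlgebra

  ⟦_⟧ : Term X → Carrier
  ⟦_⟧ = eval A ρ

  sound : ∀ {s t} → s ≃ t → ⟦ s ⟧ ≈ ⟦ t ⟧
  sound ≃-refl = refl
  sound (≃-sym e) = sym (sound e)
  sound (≃-trans e f) = trans (sound e) (sound f)
  sound (∧ᵗ-cong e f) = ∧-cong (sound e) (sound f)
  sound (∨ᵗ-cong e f) = ∨-cong (sound e) (sound f)
  sound (⇨ᵗ-cong e f) = ⇨-cong (sound e) (sound f)
  sound (-ᵗ-cong e f) = -‿cong (sound e) (sound f)
  sound (∧ᵗ-comm s t) = H.antisym
    (H.∧-greatest (H.x∧y≤y _ _) (H.x∧y≤x _ _))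
    (H.∧-greatest (H.x∧y≤y _ _) (H.x∧y≤x _ _))
  sound (∨ᵗ-comm s t) = H.antisym
    (H.∨-least (H.y≤x∨y _ _) (H.x≤x∨y _ _))
    (H.∨-least (H.y≤x∨y _ _) (H.x≤x∨y _ _))
  sound (∧ᵗ-assoc s t u) = H.antisym
    (H.∧-greatest (H.trans (H.x∧y≤x _ _) (H.x∧y≤x _ _))
      (H.∧-greatest (H.trans (H.x∧y≤x _ _) (H.x∧y≤y _ _)) (H.x∧y≤y _ _)))
    (H.∧-greatest (H.∧-greatest (H.x∧y≤x _ _) (H.trans (H.x∧y≤y _ _) (H.x∧y≤x _ _)))
      (H.trans (H.x∧y≤y _ _) (H.x∧y≤y _ _)))
  sound (∨ᵗ-assoc s t u) = H.antisym
    (H.∨-least (H.∨-least (H.x≤x∨y _ _) (H.trans (H.x≤x∨y _ _) (H.y≤x∨y _ _)))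
      (H.trans (H.y≤x∨y _ _) (H.y≤x∨y _ _)))
    (H.∨-least (H.trans (H.x≤x∨y _ _) (H.x≤x∨y _ _))
      (H.∨-least (H.trans (H.y≤x∨y _ _) (H.x≤x∨y _ _)) (H.y≤x∨y _ _)))
  sound (∨-absorbs s t) = H.antisym
    (H.∨-least H.refl (H.x∧y≤x _ _)) (H.x≤x∨y _ _)
  sound (∧-absorbs s t) = H.antisym
    (H.x∧y≤x _ _) (H.∧-greatest H.refl (H.x≤x∨y _ _))
  sound (𝟘-least s) = H.minimum ⟦ s ⟧
  sound (𝟙-most s) = H.maximum ⟦ s ⟧
  sound (⇨-intro s t u e) = H.transpose-⇨ (sound e)
  sound (⇨-elim s t u e) = H.transpose-∧ (sound e)
  sound (-‿intro s t u e) = D.transpose-⇨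
    (H.trans (sound e) (H.∨-least (H.y≤x∨y _ _) (H.x≤x∨y _ _)))
  sound (-‿elim s t u e) =
    H.trans (D.transpose-∧ (sound e)) (H.∨-least (H.y≤x∨y _ _) (H.x≤x∨y _ _))

module _ (A : Algebra c ℓ) where
  open Algebra A

  data Cg (S : List (Carrier × Carrier)) : Rel Carrier (c ⊔ ℓ) where
    Cg-base  : ∀ {x y} → (x , y) ∈ˡ S → Cg S x y
    Cg-incl  : ∀ {x y} → x ≈ y → Cg S x y
    Cg-sym   : ∀ {x y} → Cg S x y → Cg S y x
    Cg-trans : ∀ {x y z} → Cg S x y → Cg S y z → Cg S x z
    Cg-∧     : Congruent₂ (Cg S) _∧_
    Cg-∨     : Congruent₂ (Cg S) _∨_
    Cg-⇨     : Congruent₂ (Cg S) _⇨_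
    Cg--     : Congruent₂ (Cg S) _-_

  infixl 5 _/_
  _/_ : List (Carrier × Carrier) → Algebra c (c ⊔ ℓ)
  _/_ S = record
    { Carrier = Carrier ; _≈_ = Cg S
    ; _∧_ = _∧_ ; _∨_ = _∨_ ; _⇨_ = _⇨_ ; _-_ = _-_ ; 𝟘 = 𝟘 ; 𝟙 = 𝟙
    ; isEquivalence = record
      { refl  = Cg-incl (IsEquivalence.refl isEquivalence)
      ; sym   = Cg-sym
      ; trans = Cg-trans
      }
    ; ∧-cong = Cg-∧ ; ∨-cong = Cg-∨ ; ⇨-cong = Cg-⇨ ; -‿cong = Cg--
    }

  data Generated {m} (g : Fin m → Carrier) : Pred Carrier (c ⊔ ℓ) where
    gen   : ∀ i → Generated g (g i)
    gen-≈ : ∀ {x y} → x ≈ y → Generated g x → Generated g y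
    gen-∧ : ∀ {x y} → Generated g x → Generated g y → Generated g (x ∧ y)
    gen-∨ : ∀ {x y} → Generated g x → Generated g y → Generated g (x ∨ y)
    gen-⇨ : ∀ {x y} → Generated g x → Generated g y → Generated g (x ⇨ y)
    gen-- : ∀ {x y} → Generated g x → Generated g y → Generated g (x - y)
    gen-𝟘 : Generated g 𝟘
    gen-𝟙 : Generated g 𝟙

  ⟨_⟩ : ∀ {m} → (Fin m → Carrier) → Algebra (c ⊔ ℓ) ℓ
  ⟨ g ⟩ = record
    { Carrier = ∃ (Generated g)
    ; _≈_ = λ x y → proj₁ x ≈ proj₁ y
    ; _∧_ = λ (x , p) (y , q) → x ∧ y , gen-∧ p q
    ; _∨_ = λ (x , p) (y , q) → x ∨ y , gen-∨ p q
    ; _⇨_ = λ (x , p) (y , q) → x ⇨ y , gen-⇨ p q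
    ; _-_ = λ (x , p) (y , q) → x - y , gen-- p q
    ; 𝟘 = 𝟘 , gen-𝟘
    ; 𝟙 = 𝟙 , gen-𝟙
    ; isEquivalence = record { refl = refl ; sym = sym ; trans = trans }
    ; ∧-cong = ∧-cong ; ∨-cong = ∨-cong ; ⇨-cong = ⇨-cong ; -‿cong = -‿cong
    }
    where open IsEquivalence isEquivalence using (refl; sym; trans)

FinitelyPresented : Algebra c ℓ → Set (c ⊔ ℓ)
FinitelyPresented A =
  ∃[ n ] Σ[ S ∈ List (Equation (Fin n)) ] (Free (Fin n) / S) ≅ A

Coherent : (c ℓ : Level) → Set (lsuc (c ⊔ ℓ))
Coherent c ℓ =
  (A : Algebra c ℓ) → IsDoubleHeytingAlgebra A → FinitelyPresented A →
  ∀ {m} (g : Fin m → Algebra.Carrier A) → FinitelyPresented (⟨ A ⟩ g)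

Entails : (c ℓ : Level) {X : Set a} → List (Equation X) → Equation X →
          Set (a ⊔ lsuc (c ⊔ ℓ))
Entails c ℓ {X} S ε =
  (A : Algebra c ℓ) → IsDoubleHeytingAlgebra A →
  (ρ : X → Algebra.Carrier A) → All (Holds A ρ) S → Holds A ρ ε

-- The disjoint sets of variables x̄, ȳ, z̄ are the summands of
-- Fin m ⊎ (Fin n ⊎ Fin k).
RightUniformDeductiveInterpolation : (c ℓ : Level) → Set (lsuc (c ⊔ ℓ))
RightUniformDeductiveInterpolation c ℓ =
  ∀ m n (S : List (Equation (Fin m ⊎ Fin n))) →
  Σ[ P ∈ List (Equation (Fin n)) ]
  ∀ k (ε : Equation (Fin n ⊎ Fin k)) →
    Entails c ℓ (map (renameEq (Sum.map₂ inj₁)) S) (renameEq (inj₂ {A = Fin m}) ε)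
    ⇔ Entails c ℓ (map (renameEq inj₁) P) ε

-- Formulas with constants from C and n free (de Bruijn) variables, over a
-- classically complete set of connectives.
infix  6 _≐_
infixr 5 _⇒_

data Formula (C : Set c) (n : ℕ) : Set c where
  _≐_ : (s t : Term (C ⊎ Fin n)) → Formula C n
  ⊥̇   : Formula C n
  _⇒_ : (φ ψ : Formula C n) → Formula C n
  ∀̇_  : (φ : Formula C (suc n)) → Formula C n

¬̇_ : Formula C n → Formula C n
¬̇ φ = φ ⇒ ⊥̇

Sentence : Set c → Set c
Sentence C = Formula C 0

Theory : Set c → (p : Level) → Set (c ⊔ lsuc p)
Theory C p = Pred (Sentence C) p

data QuantifierFree {C : Set c} {n} : Pred (Formula C n) c where
  _≐_ : ∀ s t → QuantifierFree (s ≐ t)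
  ⊥̇   : QuantifierFree ⊥̇
  _⇒_ : ∀ {φ ψ} → QuantifierFree φ → QuantifierFree ψ → QuantifierFree (φ ⇒ ψ)

-- Tarskian satisfaction.  The double negation on atoms, vacuous under
-- excluded middle, makes every formula ¬¬-stable, so that the classical
-- calculus below is sound.
module _ (A : Algebra a ℓ) {C : Set c} (κ : C → Algebra.Carrier A) where
  open Algebra A

  Satisfies : (Fin n → Carrier) → Formula C n → Set (a ⊔ ℓ)
  Satisfies ρ (s ≐ t) = Level.Lift a (¬ ¬ (eval A [ κ , ρ ]′ s ≈ eval A [ κ , ρ ]′ t))
  Satisfies ρ ⊥̇       = Level.Lift (a ⊔ ℓ) ⊥
  Satisfies ρ (φ ⇒ ψ) = Satisfies ρ φ → Satisfies ρ ψ
  Satisfies ρ (∀̇ φ)   = ∀ x → Satisfies (x Vector.∷ ρ) φ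

-- In _⊨ᴰ_ the language is expanded by a constant for each element of A.

infix 4 _⊨_ _⊨ᴰ_

_⊨_ : Algebra a ℓ → Sentence ⊥ → Set (a ⊔ ℓ)
A ⊨ φ = Satisfies A ⊥-elim (λ ()) φ

_⊨ᴰ_ : (A : Algebra a ℓ) → Sentence (Algebra.Carrier A) → Set (a ⊔ ℓ)
A ⊨ᴰ φ = Satisfies A id (λ ()) φ

Models : Algebra a ℓ → Theory ⊥ p → Set (a ⊔ ℓ ⊔ p)
Models A T = ∀ {φ} → φ ∈ T → A ⊨ φ

lift : (Fin n → Term (C ⊎ Fin m)) → Fin (suc n) → Term (C ⊎ Fin (suc m))
lift σ = var (inj₂ zero) Vector.∷ (rename (Sum.map₂ suc) ∘ σ)

substT : (Fin n → Term (C ⊎ Fin m)) → Term (C ⊎ Fin n) → Term (C ⊎ Fin m)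
substT σ = bind [ var ∘ inj₁ , σ ]′

subst : (Fin n → Term (C ⊎ Fin m)) → Formula C n → Formula C m
subst σ (s ≐ t) = substT σ s ≐ substT σ t
subst σ ⊥̇       = ⊥̇
subst σ (φ ⇒ ψ) = subst σ φ ⇒ subst σ ψ
subst σ (∀̇ φ)   = ∀̇ subst (lift σ) φ

weaken : Formula C n → Formula C (suc n)
weaken = subst (var ∘ inj₂ ∘ suc)

infix 8 _[_]
_[_] : Formula C (suc n) → Term (C ⊎ Fin n) → Formula C n
φ [ t ] = subst (t Vector.∷ (var ∘ inj₂)) φ

mapConst : {C : Set c} {D : Set d} → (C → D) → Formula C n → Formula D n
mapConst f (s ≐ t) = rename (Sum.map₁ f) s ≐ rename (Sum.map₁ f) t
mapConst f ⊥̇       = ⊥̇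
mapConst f (φ ⇒ ψ) = mapConst f φ ⇒ mapConst f ψ
mapConst f (∀̇ φ)   = ∀̇ mapConst f φ

-- Classical natural deduction with equality: T is the set of axioms, Γ the
-- open assumptions.
infix 3 _∣_⊢_

data _∣_⊢_ {C : Set c} (T : Theory C p) {n} (Γ : List (Formula C n)) :
           Formula C n → Set (c ⊔ p) where
  axiom   : ∀ {φ} → φ ∈ T → T ∣ Γ ⊢ subst (λ ()) φ
  assume  : ∀ {φ} → φ ∈ˡ Γ → T ∣ Γ ⊢ φ
  ⇒-intro : ∀ {φ ψ} → T ∣ φ ∷ Γ ⊢ ψ → T ∣ Γ ⊢ φ ⇒ ψ
  ⇒-elim  : ∀ {φ ψ} → T ∣ Γ ⊢ φ ⇒ ψ → T ∣ Γ ⊢ φ → T ∣ Γ ⊢ ψ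
  raa     : ∀ {φ} → T ∣ ¬̇ φ ∷ Γ ⊢ ⊥̇ → T ∣ Γ ⊢ φ
  ∀-intro : ∀ {φ} → T ∣ map weaken Γ ⊢ φ → T ∣ Γ ⊢ ∀̇ φ
  ∀-elim  : ∀ {φ} → T ∣ Γ ⊢ ∀̇ φ → ∀ t → T ∣ Γ ⊢ φ [ t ]
  ≐-refl  : ∀ t → T ∣ Γ ⊢ t ≐ t
  ≐-subst : ∀ φ {s t} → T ∣ Γ ⊢ s ≐ t → T ∣ Γ ⊢ φ [ s ] → T ∣ Γ ⊢ φ [ t ]

infix 3 _⊢_
_⊢_ : {C : Set c} → Theory C p → Sentence C → Set (c ⊔ p)
T ⊢ φ = T ∣ [] ⊢ φ

Complete : {C : Set c} → Theory C p → Set (c ⊔ p)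
Complete T = ¬ (T ⊢ ⊥̇) × (∀ φ → (T ⊢ φ) ⊎ (T ⊢ ¬̇ φ))

Expand : (C : Set c) → Theory ⊥ p → Theory C (c ⊔ p)
Expand C T φ = ∃[ ψ ] ψ ∈ T × φ ≡ mapConst ⊥-elim ψ

Diagram : (A : Algebra a ℓ) → Theory (Algebra.Carrier A) (a ⊔ ℓ)
Diagram A φ = QuantifierFree φ × A ⊨ᴰ φ

record IsModelCompletion (c ℓ : Level) {p p′} (T : Theory ⊥ p) (T* : Theory ⊥ p′) :
                         Set (lsuc (c ⊔ ℓ) ⊔ p ⊔ p′) where
  field
    extends  : T ⊆ T*
    embeds   : (M : Algebra c ℓ) → Models M T →
               Σ[ N ∈ Algebra c ℓ ] Models N T* × Embeds M N
    complete : (M : Algebra c ℓ) → Models M T →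
               Complete (Expand (Algebra.Carrier M) T* ∪ Diagram M)

Th : (c ℓ : Level) → Theory ⊥ (lsuc (c ⊔ ℓ))
Th c ℓ φ = (A : Algebra c ℓ) → IsDoubleHeytingAlgebra A → A ⊨ φ

HasModelCompletion : (c ℓ p : Level) → Set (lsuc (c ⊔ ℓ ⊔ p))
HasModelCompletion c ℓ p = Σ[ T* ∈ Theory ⊥ p ] IsModelCompletion c ℓ (Th c ℓ) T*

{-# OPTIONS --safe #-}

-- Write □ s = (1 - s) → 0.  An element x with x ∧ (1 - x) = 0 satisfies x ≤ z ⇒ x ≤ □ z,
-- so if y ≤ x ≤ z for such an x then y ≤ □ᵏ z for all k.  No finite set of equations
-- in y, z captures these consequences: a fence of length n, with y its left end and z
-- everything but its right end, refutes y ≤ □ⁿ z, while for large n it is locally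
-- indistinguishable from two disjoint rays, where the left ray is an x between y and z.
-- Algebras are given by Kripke models (terms modulo forcing equivalence), and local
-- indistinguishability is bounded bisimulation.
-- All three properties would yield such a finite set; for a model completion T*,
-- it is the finite part of the diagram of the two rays used in deciding
-- "there is no interpolant x".

module Submission where

open import Data.Bool.Base using (Bool; true; false; T)
open import Data.Empty using (⊥; ⊥-elim)
open import Data.Fin.Base using (Fin; zero; suc; splitAt)
open import Data.Fin.Patterns using (0F; 1F; 2F)
open import Data.List.Base using (List; []; _∷_; map; _++_; tabulate)
import Data.List.Membership.Propositional.Properties as ∈ˡ
open import Data.List.Relation.Unary.Any using (here; there)
open import Data.List.Relation.Unary.All as All using (All; []; _∷_)
import Data.List.Relation.Unary.All.Properties as All
open import Data.Nat.Base using (ℕ; zero; suc; _+_; _∸_; _⊔_; _≤_; _<_; s≤s)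
import Data.Nat.Properties as ℕ
open import Data.Product.Base using (∃; ∃-syntax; _×_; _,_; proj₁; proj₂)
open import Data.Sum.Base as Sum using (_⊎_; inj₁; inj₂; [_,_]′)
open import Data.Unit.Base using (⊤; tt)
import Data.Vec.Functional as Vector
open import Function.Base using (id; _∘_; flip)
open import Function.Bundles using (_⇔_; mk⇔; module Equivalence)
import Function.Properties.Equivalence as ⇔
open import Function.Definitions using (Injective)
open import Level using (Level; Lift; lower; 0ℓ) renaming (lift to ↑; _⊔_ to _⊔ˡ_)
open import Relation.Binary.Core using (Rel; REL)
open import Relation.Binary.Lattice.Structures using (IsHeytingAlgebra)
open import Relation.Binary.PropositionalEquality.Core as ≡ using (_≡_; refl)
open import Relation.Binary.Structures using (IsEquivalence)
open import Relation.Nullary.Decidable.Core using (yes; no; ¬¬-excluded-middle)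
open import Relation.Nullary.Negation.Core using (¬_; Stable; contradiction; ¬¬-map; negated-stable)
open import Relation.Unary using (_∈_; _∪_)
open import Defs

open Equivalence using (to; from)

private
  variable
    a b c ℓ ℓ′ p r : Level
    X Y : Set a
    n : ℕ

-- Algebras and evaluation

-- One induction on terms, `eval-rel`, serves four relations: equality, its double negation, the
-- graph of a homomorphism, and propositional equality between two algebras on the same carrier.
record Logical (A : Algebra a ℓ) (B : Algebra b ℓ′)
               (R : REL (Algebra.Carrier A) (Algebra.Carrier B) r) : Set (a ⊔ˡ b ⊔ˡ r) where
  private
    module A = Algebra A
    module B = Algebra B
  field
    ∧-rel : ∀ {x x′ y y′} → R x x′ → R y y′ → R (x A.∧ y) (x′ B.∧ y′)
    ∨-rel : ∀ {x x′ y y′} → R x x′ → R y y′ → R (x A.∨ y) (x′ B.∨ y′)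
    ⇨-rel : ∀ {x x′ y y′} → R x x′ → R y y′ → R (x A.⇨ y) (x′ B.⇨ y′)
    -‿rel : ∀ {x x′ y y′} → R x x′ → R y y′ → R (x A.- y) (x′ B.- y′)
    𝟘-rel : R A.𝟘 B.𝟘
    𝟙-rel : R A.𝟙 B.𝟙

  eval-rel : {ρ : X → A.Carrier} {ρ′ : X → B.Carrier} →
             (∀ x → R (ρ x) (ρ′ x)) → ∀ s → R (eval A ρ s) (eval B ρ′ s)
  eval-rel h (var x)  = h x
  eval-rel h (s ∧ᵗ t) = ∧-rel (eval-rel h s) (eval-rel h t)
  eval-rel h (s ∨ᵗ t) = ∨-rel (eval-rel h s) (eval-rel h t)
  eval-rel h (s ⇨ᵗ t) = ⇨-rel (eval-rel h s) (eval-rel h t)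
  eval-rel h (s -ᵗ t) = -‿rel (eval-rel h s) (eval-rel h t)
  eval-rel h 𝟘ᵗ       = 𝟘-rel
  eval-rel h 𝟙ᵗ       = 𝟙-rel

open Logical using (eval-rel)

module Equality (A : Algebra a ℓ) where
  open Algebra A
  open IsEquivalence isEquivalence public
    using () renaming (refl to ≈-refl; sym to ≈-sym; trans to ≈-trans; reflexive to ≈-reflexive)

  ≈-logical : Logical A A _≈_
  ≈-logical = record
    { ∧-rel = ∧-cong ; ∨-rel = ∨-cong ; ⇨-rel = ⇨-cong ; -‿rel = -‿cong
    ; 𝟘-rel = ≈-refl ; 𝟙-rel = ≈-refl }

  ¬¬≈-logical : Logical A A (λ x y → ¬ ¬ (x ≈ y))
  ¬¬≈-logical = record
    { ∧-rel = lift₂ ∧-cong ; ∨-rel = lift₂ ∨-cong ; ⇨-rel = lift₂ ⇨-cong ; -‿rel = lift₂ -‿cong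
    ; 𝟘-rel = contradiction ≈-refl ; 𝟙-rel = contradiction ≈-refl }
    where
    lift₂ : ∀ {P Q R : Set ℓ} → (P → Q → R) → ¬ ¬ P → ¬ ¬ Q → ¬ ¬ R
    lift₂ f ¬¬p ¬¬q ¬r = ¬¬p λ p → ¬¬q λ q → ¬r (f p q)

  eval-bind : (ρ : Y → Carrier) (σ : X → Term Y) (s : Term X) →
              eval A ρ (bind σ s) ≡ eval A (eval A ρ ∘ σ) s
  eval-bind ρ σ (var x)  = refl
  eval-bind ρ σ (s ∧ᵗ t) = ≡.cong₂ _∧_ (eval-bind ρ σ s) (eval-bind ρ σ t)
  eval-bind ρ σ (s ∨ᵗ t) = ≡.cong₂ _∨_ (eval-bind ρ σ s) (eval-bind ρ σ t)
  eval-bind ρ σ (s ⇨ᵗ t) = ≡.cong₂ _⇨_ (eval-bind ρ σ s) (eval-bind ρ σ t)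
  eval-bind ρ σ (s -ᵗ t) = ≡.cong₂ _-_ (eval-bind ρ σ s) (eval-bind ρ σ t)
  eval-bind ρ σ 𝟘ᵗ       = refl
  eval-bind ρ σ 𝟙ᵗ       = refl

  holds-≈ : ∀ {s t s′ t′} → s ≈ s′ → t ≈ t′ → (s ≈ t) ⇔ (s′ ≈ t′)
  holds-≈ p q = mk⇔ (λ e → ≈-trans (≈-sym p) (≈-trans e q)) (λ e → ≈-trans p (≈-trans e (≈-sym q)))

  holds-bind : {ρ : Y → Carrier} {σ : X → Term Y} {ρ′ : X → Carrier} →
               (∀ x → eval A ρ (σ x) ≈ ρ′ x) → ∀ s t →
               Holds A ρ (bind σ s , bind σ t) ⇔ Holds A ρ′ (s , t)
  holds-bind {ρ = ρ} {σ} h s t = holds-≈ (eval-bind-≈ s) (eval-bind-≈ t)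
    where
    eval-bind-≈ : ∀ s → eval A ρ (bind σ s) ≈ eval A _ s
    eval-bind-≈ s = ≈-trans (≈-reflexive (eval-bind ρ σ s)) (eval-rel ≈-logical h s)

module Homomorphism {A : Algebra a ℓ} {B : Algebra b ℓ′}
                    {h : Algebra.Carrier A → Algebra.Carrier B}
                    (hom : IsHomomorphism A B h) where
  private
    module A = Algebra A
    module B = Algebra B
  open IsHomomorphism hom
  open Equality B

  graph-logical : Logical A B (λ x y → h x B.≈ y)
  graph-logical = record
    { ∧-rel = λ p q → ≈-trans (∧-homo _ _) (B.∧-cong p q)
    ; ∨-rel = λ p q → ≈-trans (∨-homo _ _) (B.∨-cong p q)
    ; ⇨-rel = λ p q → ≈-trans (⇨-homo _ _) (B.⇨-cong p q)
    ; -‿rel = λ p q → ≈-trans (-‿homo _ _) (B.-‿cong p q)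
    ; 𝟘-rel = 𝟘-homo ; 𝟙-rel = 𝟙-homo }

  holds-hom : {ρ : X → A.Carrier} {ρ′ : X → B.Carrier} →
              (∀ x → h (ρ x) B.≈ ρ′ x) → ∀ s t → Holds A ρ (s , t) → Holds B ρ′ (s , t)
  holds-hom ρ≈ s t e =
    to (holds-≈ (eval-rel graph-logical ρ≈ s) (eval-rel graph-logical ρ≈ t)) (cong e)

  holds-embedding : Injective A._≈_ B._≈_ h → {ρ : X → A.Carrier} {ρ′ : X → B.Carrier} →
                    (∀ x → h (ρ x) B.≈ ρ′ x) → ∀ s t → Holds A ρ (s , t) ⇔ Holds B ρ′ (s , t)
  holds-embedding inj ρ≈ s t = mk⇔ (holds-hom ρ≈ s t)
    (λ e → inj (from (holds-≈ (eval-rel graph-logical ρ≈ s) (eval-rel graph-logical ρ≈ t)) e))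

open Homomorphism using (holds-hom; holds-embedding)

-- Constructions of double-Heyting algebras

module DoubleHeyting {A : Algebra c ℓ} (dha : IsDoubleHeytingAlgebra A) where
  open Algebra A renaming (_≤_ to _⊑_)
  open IsDoubleHeytingAlgebra dha
  open IsHeytingAlgebra isHeytingAlgebra public
  private module D = IsHeytingAlgebra isDualHeytingAlgebra

  ∨-comm-≤ : ∀ {x y} → x ∨ y ⊑ y ∨ x
  ∨-comm-≤ = ∨-least (y≤x∨y _ _) (x≤x∨y _ _)

  residual-intro : ∀ {x y z} → x ⊑ y ∨ z → x - y ⊑ z
  residual-intro e = D.transpose-⇨ (trans e ∨-comm-≤)

  residual-elim : ∀ {x y z} → x - y ⊑ z → x ⊑ y ∨ z
  residual-elim e = trans (D.transpose-∧ e) ∨-comm-≤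

-- The natural order `x ≈ x ∧ y` is awkward to check laws for. Each algebra below has a handier
-- description `_⊴_` of the same order, for which it suffices to check them.
record OrderPresentation (A : Algebra c ℓ) (_⊴_ : Rel (Algebra.Carrier A) r) : Set (c ⊔ˡ ℓ ⊔ˡ r) where
  open Algebra A renaming (_≤_ to _⊑_)
  field
    order  : ∀ {x y} → (x ⊑ y) ⇔ (x ⊴ y)
    reflexive : ∀ {x y} → x ≈ y → x ⊴ y
    trans     : ∀ {x y z} → x ⊴ y → y ⊴ z → x ⊴ z
    antisym   : ∀ {x y} → x ⊴ y → y ⊴ x → x ≈ y
    ∧-lower₁  : ∀ {x y} → (x ∧ y) ⊴ x
    ∧-lower₂  : ∀ {x y} → (x ∧ y) ⊴ y
    ∧-glb     : ∀ {x y z} → x ⊴ y → x ⊴ z → x ⊴ (y ∧ z)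
    ∨-upper₁  : ∀ {x y} → x ⊴ (x ∨ y)
    ∨-upper₂  : ∀ {x y} → y ⊴ (x ∨ y)
    ∨-lub     : ∀ {x y z} → x ⊴ z → y ⊴ z → (x ∨ y) ⊴ z
    𝟘-min     : ∀ {x} → 𝟘 ⊴ x
    𝟙-max     : ∀ {x} → x ⊴ 𝟙
    ⇨-adjoint : ∀ {x y z} → ((x ∧ y) ⊴ z) ⇔ (x ⊴ (y ⇨ z))
    -‿adjoint : ∀ {x y z} → (x ⊴ (y ∨ z)) ⇔ ((x - y) ⊴ z)

  private
    ∨-comm-⊴ : ∀ {x y} → (x ∨ y) ⊴ (y ∨ x)
    ∨-comm-⊴ = ∨-lub ∨-upper₂ ∨-upper₁

    ⊑-refl : ∀ {x y} → x ≈ y → x ⊑ y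
    ⊑-refl e = from order (reflexive e)

    ⊑-trans : ∀ {x y z} → x ⊑ y → y ⊑ z → x ⊑ z
    ⊑-trans e f = from order (trans (to order e) (to order f))

    ⊑-antisym : ∀ {x y} → x ⊑ y → y ⊑ x → x ≈ y
    ⊑-antisym e f = antisym (to order e) (to order f)

  isDoubleHeytingAlgebra : IsDoubleHeytingAlgebra A
  isDoubleHeytingAlgebra = record
    { isHeytingAlgebra = record
      { isBoundedLattice = record
        { isLattice = record
          { isPartialOrder = record
            { isPreorder = record
              { isEquivalence = isEquivalence ; reflexive = ⊑-refl ; trans = ⊑-trans }
            ; antisym = ⊑-antisym
            }
          ; supremum = supremum
          ; infimum  = infimum
          }
        ; maximum = λ _ → from order 𝟙-max
        ; minimum = λ _ → from order 𝟘-min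
        }
      ; exponential = λ _ _ _ →
          (λ e → from order (to ⇨-adjoint (to order e)))
        , (λ e → from order (from ⇨-adjoint (to order e)))
      }
    ; isDualHeytingAlgebra = record
      { isBoundedLattice = record
        { isLattice = record
          { isPartialOrder = record
            { isPreorder = record
              { isEquivalence = isEquivalence
              ; reflexive = λ e → ⊑-refl (≈-sym e)
              ; trans = flip ⊑-trans
              }
            ; antisym = flip ⊑-antisym
            }
          ; supremum = infimum
          ; infimum  = supremum
          }
        ; maximum = λ _ → from order 𝟘-min
        ; minimum = λ _ → from order 𝟙-max
        }
      ; exponential = λ _ _ _ →
          (λ e → from order (to -‿adjoint (trans (to order e) ∨-comm-⊴)))
        , (λ e → from order (trans (from -‿adjoint (to order e)) ∨-comm-⊴))
      }
    }
    where
    open Equality A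
    infimum : ∀ x y → (x ∧ y) ⊑ x × (x ∧ y) ⊑ y × (∀ z → z ⊑ x → z ⊑ y → z ⊑ (x ∧ y))
    infimum _ _ = from order ∧-lower₁ , from order ∧-lower₂
                , (λ _ e f → from order (∧-glb (to order e) (to order f)))
    supremum : ∀ x y → x ⊑ (x ∨ y) × y ⊑ (x ∨ y) × (∀ z → x ⊑ z → y ⊑ z → (x ∨ y) ⊑ z)
    supremum _ _ = from order ∨-upper₁ , from order ∨-upper₂
                 , (λ _ e f → from order (∨-lub (to order e) (to order f)))

-- The models are built at level zero, while the theorem concerns algebras at arbitrary levels.
Lifted : ∀ c ℓ → Algebra 0ℓ 0ℓ → Algebra c ℓ
Lifted c ℓ A = record
  { Carrier = Lift c Carrier
  ; _≈_ = λ x y → Lift ℓ (lower x ≈ lower y)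
  ; _∧_ = λ x y → ↑ (lower x ∧ lower y)
  ; _∨_ = λ x y → ↑ (lower x ∨ lower y)
  ; _⇨_ = λ x y → ↑ (lower x ⇨ lower y)
  ; _-_ = λ x y → ↑ (lower x - lower y)
  ; 𝟘 = ↑ 𝟘
  ; 𝟙 = ↑ 𝟙
  ; isEquivalence = record
    { refl = ↑ ≈-refl
    ; sym = λ e → ↑ (≈-sym (lower e))
    ; trans = λ e f → ↑ (≈-trans (lower e) (lower f)) }
  ; ∧-cong = λ e f → ↑ (∧-cong (lower e) (lower f))
  ; ∨-cong = λ e f → ↑ (∨-cong (lower e) (lower f))
  ; ⇨-cong = λ e f → ↑ (⇨-cong (lower e) (lower f))
  ; -‿cong = λ e f → ↑ (-‿cong (lower e) (lower f))
  }
  where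
  open Algebra A
  open Equality A

Lifted-isDoubleHeytingAlgebra : ∀ {A} → IsDoubleHeytingAlgebra A →
                                IsDoubleHeytingAlgebra (Lifted c ℓ A)
Lifted-isDoubleHeytingAlgebra {A = A} dha = OrderPresentation.isDoubleHeytingAlgebra record
  { order = mk⇔ lower ↑
  ; reflexive = λ e → D.reflexive (lower e)
  ; trans = D.trans
  ; antisym = λ e f → ↑ (D.antisym e f)
  ; ∧-lower₁ = D.x∧y≤x _ _ ; ∧-lower₂ = D.x∧y≤y _ _ ; ∧-glb = D.∧-greatest
  ; ∨-upper₁ = D.x≤x∨y _ _ ; ∨-upper₂ = D.y≤x∨y _ _ ; ∨-lub = D.∨-least
  ; 𝟘-min = D.minimum _ ; 𝟙-max = D.maximum _
  ; ⇨-adjoint = mk⇔ D.transpose-⇨ D.transpose-∧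
  ; -‿adjoint = mk⇔ D.residual-intro D.residual-elim
  }
  where module D = DoubleHeyting dha

↑-isHomomorphism : ∀ c ℓ A → IsHomomorphism A (Lifted c ℓ A) ↑
↑-isHomomorphism c ℓ A = record
  { cong = ↑ ; ∧-homo = λ _ _ → ↑ ≈-refl ; ∨-homo = λ _ _ → ↑ ≈-refl
  ; ⇨-homo = λ _ _ → ↑ ≈-refl ; -‿homo = λ _ _ → ↑ ≈-refl ; 𝟘-homo = ↑ ≈-refl ; 𝟙-homo = ↑ ≈-refl }
  where open Equality A

module Quotient {A : Algebra c ℓ} (dha : IsDoubleHeytingAlgebra A)
                (S : List (Algebra.Carrier A × Algebra.Carrier A)) where
  open Algebra A renaming (_≤_ to _⊑_)
  open DoubleHeyting dha

  private
    _~_ : Rel Carrier _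
    _~_ = Cg A S

    ~-refl : ∀ {x} → x ~ x
    ~-refl = Cg-incl Eq.refl

    -- A congruence step followed by an inequality of `A`: the laws of `A` then apply directly to
    -- the second factor, and only the first involves `Cg`.
    _⊴_ : Rel Carrier _
    x ⊴ y = ∃[ w ] x ~ w × w ⊑ y

    incl : ∀ {x y} → x ⊑ y → x ⊴ y
    incl e = _ , ~-refl , e

    ∧-idem : ∀ {x} → x ~ (x ∧ x)
    ∧-idem = Cg-incl (antisym (∧-greatest refl′ refl′) (x∧y≤x _ _))
      where refl′ = reflexive Eq.refl

    ∧-comm : ∀ {x y} → (x ∧ y) ~ (y ∧ x)
    ∧-comm = Cg-incl (antisym (∧-greatest (x∧y≤y _ _) (x∧y≤x _ _)) (∧-greatest (x∧y≤y _ _) (x∧y≤x _ _)))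

    ⊴⇒~ : ∀ {x y} → x ⊴ y → x ~ (x ∧ y)
    ⊴⇒~ (_ , e , f) = Cg-trans e (Cg-trans (Cg-incl f) (Cg-∧ (Cg-sym e) ~-refl))

  isDoubleHeytingAlgebra : IsDoubleHeytingAlgebra (A / S)
  isDoubleHeytingAlgebra = OrderPresentation.isDoubleHeytingAlgebra {_⊴_ = _⊴_} record
    { order = mk⇔ (λ e → _ , e , x∧y≤y _ _) ⊴⇒~
    ; reflexive = λ e → _ , e , reflexive Eq.refl
    ; trans = λ { (_ , e , e′) (_ , f , f′) →
        _ , Cg-trans e (Cg-trans (Cg-incl e′) (Cg-∧ ~-refl f)) , trans (x∧y≤y _ _) f′ }
    ; antisym = λ e f → Cg-trans (⊴⇒~ e) (Cg-trans ∧-comm (Cg-sym (⊴⇒~ f)))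
    ; ∧-lower₁ = incl (x∧y≤x _ _) ; ∧-lower₂ = incl (x∧y≤y _ _)
    ; ∧-glb = λ { (_ , e , e′) (_ , f , f′) →
        _ , Cg-trans ∧-idem (Cg-∧ e f)
          , ∧-greatest (trans (x∧y≤x _ _) e′) (trans (x∧y≤y _ _) f′) }
    ; ∨-upper₁ = incl (x≤x∨y _ _) ; ∨-upper₂ = incl (y≤x∨y _ _)
    ; ∨-lub = λ { (_ , e , e′) (_ , f , f′) → _ , Cg-∨ e f , ∨-least e′ f′ }
    ; 𝟘-min = incl (minimum _) ; 𝟙-max = incl (maximum _)
    ; ⇨-adjoint = mk⇔
        -- From `x ≤ y ⇨ (x ∧ y)` the element `x` equals its meet with `y ⇨ (x ∧ y)`, in which
        -- `x ∧ y` may be replaced by the congruent `w`. The residual is treated alike through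
        -- `x ≤ y ∨ (x - y)`.
        (λ { (w , e , e′) →
          _ , Cg-trans (Cg-incl (transpose-⇨ (reflexive Eq.refl))) (Cg-∧ ~-refl (Cg-⇨ ~-refl e))
            , trans (x∧y≤y _ _) (transpose-⇨ (trans (transpose-∧ (reflexive Eq.refl)) e′)) })
        (λ { (w , e , e′) → _ , Cg-∧ e ~-refl , transpose-∧ e′ })
    ; -‿adjoint = mk⇔
        (λ { (w , e , e′) → _ , Cg-- e ~-refl , residual-intro e′ })
        (λ { (w , e , e′) →
          _ , Cg-trans (Cg-incl (residual-elim (reflexive Eq.refl))) (Cg-∧ ~-refl (Cg-∨ ~-refl e))
            , trans (x∧y≤y _ _) (∨-least (x≤x∨y _ _) (trans e′ (y≤x∨y _ _))) })
    }

Cg-sound : {S : List (Equation X)} {A : Algebra c ℓ} → IsDoubleHeytingAlgebra A →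
           {ρ : X → Algebra.Carrier A} → All (Holds A ρ) S →
           ∀ {s t} → Cg (Free X) S s t → Holds A ρ (s , t)
Cg-sound {X = X} {S = S} {A} dha {ρ} hS = go
  where
  open Algebra A
  open Equality A
  go : ∀ {s t} → Cg (Free X) S s t → Holds A ρ (s , t)
  go (Cg-base e)    = All.lookup hS e
  go (Cg-incl e)    = IsHomomorphism.cong (eval-isHomomorphism A dha ρ) e
  go (Cg-sym e)     = ≈-sym (go e)
  go (Cg-trans e f) = ≈-trans (go e) (go f)
  go (Cg-∧ e f)     = ∧-cong (go e) (go f)
  go (Cg-∨ e f)     = ∨-cong (go e) (go f)
  go (Cg-⇨ e f)     = ⇨-cong (go e) (go f)
  go (Cg-- e f)     = -‿cong (go e) (go f)

generated⇒term : (A : Algebra c ℓ) {m : ℕ} {g : Fin m → Algebra.Carrier A} → ∀ {x} →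
                 Generated A g x → ∃[ s ] Algebra._≈_ A (eval A g s) x
generated⇒term A = go
  where
  open Algebra A
  open Equality A
  go : ∀ {m} {g : Fin m → Carrier} {x} → Generated A g x → ∃[ s ] eval A g s ≈ x
  go (gen i)     = var i , ≈-refl
  go (gen-≈ e p) = let s , h = go p in s , ≈-trans h e
  go (gen-∧ p q) = let s , h = go p ; t , k = go q in s ∧ᵗ t , ∧-cong h k
  go (gen-∨ p q) = let s , h = go p ; t , k = go q in s ∨ᵗ t , ∨-cong h k
  go (gen-⇨ p q) = let s , h = go p ; t , k = go q in s ⇨ᵗ t , ⇨-cong h k
  go (gen-- p q) = let s , h = go p ; t , k = go q in s -ᵗ t , -‿cong h k
  go gen-𝟘       = 𝟘ᵗ , ≈-refl
  go gen-𝟙       = 𝟙ᵗ , ≈-refl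

-- Kripke models

-- Boolean valuations make forcing of a variable stable under double negation, the base case of
-- `⊩-stable`.
record Kripke (X : Set) : Set₁ where
  field
    Point : Set
    _⊑_   : Rel Point 0ℓ
    ⊑-refl  : ∀ {p} → p ⊑ p
    ⊑-trans : ∀ {p q r} → p ⊑ q → q ⊑ r → p ⊑ r
    V     : X → Point → Bool
    V-up  : ∀ x {p q} → p ⊑ q → T (V x p) → T (V x q)

T-stable : ∀ b → Stable (T b)
T-stable true  _  = tt
T-stable false ¬¬p = ¬¬p id

module Forcing {X : Set} (K : Kripke X) where
  open Kripke K

  infix 3 _⊩_

  -- The clauses for _∨ᵗ_ and _-ᵗ_ are negated so that forcing is ¬¬-stable,
  -- which the dual residuation law needs.
  _⊩_ : Point → Term X → Set
  p ⊩ var x  = T (V x p)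
  p ⊩ s ∧ᵗ t = (p ⊩ s) × (p ⊩ t)
  p ⊩ s ∨ᵗ t = ¬ (¬ (p ⊩ s) × ¬ (p ⊩ t))
  p ⊩ s ⇨ᵗ t = ∀ q → p ⊑ q → q ⊩ s → q ⊩ t
  p ⊩ s -ᵗ t = ¬ (∀ q → q ⊑ p → q ⊩ s → q ⊩ t)
  p ⊩ 𝟘ᵗ     = ⊥
  p ⊩ 𝟙ᵗ     = ⊤

  ⊩-up : ∀ s {p q} → p ⊑ q → p ⊩ s → q ⊩ s
  ⊩-up (var x)  p⊑q h = V-up x p⊑q h
  ⊩-up (s ∧ᵗ t) p⊑q (h , k) = ⊩-up s p⊑q h , ⊩-up t p⊑q k
  ⊩-up (s ∨ᵗ t) p⊑q h (¬s , ¬t) = h (¬s ∘ ⊩-up s p⊑q , ¬t ∘ ⊩-up t p⊑q)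
  ⊩-up (s ⇨ᵗ t) p⊑q h r q⊑r = h r (⊑-trans p⊑q q⊑r)
  ⊩-up (s -ᵗ t) p⊑q h k = h λ r r⊑p → k r (⊑-trans r⊑p p⊑q)
  ⊩-up 𝟙ᵗ       p⊑q h = tt

  ⊩-stable : ∀ s {p} → Stable (p ⊩ s)
  ⊩-stable (var x)  h = T-stable _ h
  ⊩-stable (s ∧ᵗ t) h = ⊩-stable s (¬¬-map proj₁ h) , ⊩-stable t (¬¬-map proj₂ h)
  ⊩-stable (s ∨ᵗ t) h = negated-stable h
  ⊩-stable (s ⇨ᵗ t) h q p⊑q k = ⊩-stable t (¬¬-map (λ f → f q p⊑q k) h)
  ⊩-stable (s -ᵗ t) h = negated-stable h
  ⊩-stable 𝟘ᵗ       h = h id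
  ⊩-stable 𝟙ᵗ       h = tt

  _⊴_ : Rel (Term X) 0ℓ
  s ⊴ t = ∀ p → p ⊩ s → p ⊩ t

  ⊴-case : ∀ s t u → s ⊴ u → t ⊴ u → (s ∨ᵗ t) ⊴ u
  ⊴-case s t u e f p h = ⊩-stable u λ ¬u → h (¬u ∘ e p , ¬u ∘ f p)

  -- Left to right, if `u` fails at `p` then by persistence it fails at all `q` below `p`, so each
  -- such `q` forcing `s` forces `t`, against `s -ᵗ t` at `p`. Right to left, `p` itself witnesses
  -- `s -ᵗ t`.
  ⊴-residual : ∀ s t u → s ⊴ (t ∨ᵗ u) ⇔ (s -ᵗ t) ⊴ u
  ⊴-residual s t u = mk⇔
    (λ e p h → ⊩-stable u λ ¬u → h λ q q⊑p k → ⊩-stable t λ ¬t → e q k (¬t , ¬u ∘ ⊩-up u q⊑p))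
    (λ e p h (¬t , ¬u) → ¬u (e p λ k → ¬t (k p ⊑-refl h)))

  infix 4 _≋_

  -- A record rather than a pair, so that s and t can be inferred from s ≋ t.
  record _≋_ (s t : Term X) : Set where
    constructor _⇋_
    field
      ⊩-to   : s ⊴ t
      ⊩-from : t ⊴ s

  open _≋_ public

  -- This is the algebra of term-definable up-sets. Since the elements are the terms themselves,
  -- each has a finite `depth`, and models on the same variables share carrier and operations.
  Alg : Algebra 0ℓ 0ℓ
  Alg = record
    { Carrier = Term X
    ; _≈_ = _≋_
    ; _∧_ = _∧ᵗ_ ; _∨_ = _∨ᵗ_ ; _⇨_ = _⇨ᵗ_ ; _-_ = _-ᵗ_ ; 𝟘 = 𝟘ᵗ ; 𝟙 = 𝟙ᵗ
    ; isEquivalence = record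
      { refl  = (λ _ → id) ⇋ (λ _ → id)
      ; sym   = λ (e ⇋ f) → f ⇋ e
      ; trans = λ (e ⇋ f) (e′ ⇋ f′) → (λ p → e′ p ∘ e p) ⇋ (λ p → f p ∘ f′ p) }
    ; ∧-cong = λ (e ⇋ f) (e′ ⇋ f′) →
        (λ p (h , k) → e p h , e′ p k) ⇋ (λ p (h , k) → f p h , f′ p k)
    ; ∨-cong = λ (e ⇋ f) (e′ ⇋ f′) →
        (λ p h (¬s , ¬t) → h (¬s ∘ e p , ¬t ∘ e′ p)) ⇋ (λ p h (¬s , ¬t) → h (¬s ∘ f p , ¬t ∘ f′ p))
    ; ⇨-cong = λ (e ⇋ f) (e′ ⇋ f′) →
        (λ p h q p⊑q → e′ q ∘ h q p⊑q ∘ f q) ⇋ (λ p h q p⊑q → f′ q ∘ h q p⊑q ∘ e q)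
    ; -‿cong = λ (e ⇋ f) (e′ ⇋ f′) →
        (λ p h k → h λ q q⊑p → f′ q ∘ k q q⊑p ∘ e q) ⇋ (λ p h k → h λ q q⊑p → e′ q ∘ k q q⊑p ∘ f q)
    }

  ⊴⇒≤ : ∀ {s t} → s ⊴ t → Algebra._≤_ Alg s t
  ⊴⇒≤ e = (λ p h → h , e p h) ⇋ (λ _ → proj₁)

  Alg-isDoubleHeytingAlgebra : IsDoubleHeytingAlgebra Alg
  Alg-isDoubleHeytingAlgebra = OrderPresentation.isDoubleHeytingAlgebra {_⊴_ = _⊴_} record
    { order = mk⇔ (λ (e ⇋ _) p → proj₂ ∘ e p) ⊴⇒≤
    ; reflexive = ⊩-to
    ; trans = λ e f p → f p ∘ e p
    ; antisym = _⇋_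
    ; ∧-lower₁ = λ _ → proj₁ ; ∧-lower₂ = λ _ → proj₂ ; ∧-glb = λ e f p h → e p h , f p h
    ; ∨-upper₁ = λ _ h (¬s , _) → ¬s h
    ; ∨-upper₂ = λ _ h (_ , ¬t) → ¬t h
    ; ∨-lub = λ {s t u} → ⊴-case s t u
    ; 𝟘-min = λ _ () ; 𝟙-max = λ _ _ → tt
    ; ⇨-adjoint = λ {s t u} → mk⇔
        (λ e p h q p⊑q k → e q (⊩-up s p⊑q h , k)) (λ e p (h , k) → e p h p ⊑-refl k)
    ; -‿adjoint = λ {s t u} → ⊴-residual s t u
    }

open Forcing using (_⇋_; Alg; Alg-isDoubleHeytingAlgebra)

-- Bounded bisimulation

depth : Term X → ℕ
depth (var _)  = 0
depth (s ∧ᵗ t) = depth s ⊔ depth t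
depth (s ∨ᵗ t) = depth s ⊔ depth t
depth (s ⇨ᵗ t) = suc (depth s ⊔ depth t)
depth (s -ᵗ t) = suc (depth s ⊔ depth t)
depth 𝟘ᵗ       = 0
depth 𝟙ᵗ       = 0

-- The bound counts the remaining moves along the order, one for each nested `⇨ᵗ` or `-ᵗ`. The
-- former looks up and the latter down, so moves both ways are matched.
record BoundedBisimulation {X Y} (f : X → Y) (K : Kripke X) (L : Kripke Y)
                           (Z : ℕ → REL (Kripke.Point K) (Kripke.Point L) 0ℓ) : Set where
  private
    module K = Kripke K
    module L = Kripke L
    module K⊩ = Forcing K
    module L⊩ = Forcing L
  field
    atom      : ∀ {r p q} → Z r p q → ∀ x → K.V x p ≡ L.V (f x) q
    forth-up  : ∀ {r p q p′} → Z (suc r) p q → p K.⊑ p′ → ∃[ q′ ] q L.⊑ q′ × Z r p′ q′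
    back-up   : ∀ {r p q q′} → Z (suc r) p q → q L.⊑ q′ → ∃[ p′ ] p K.⊑ p′ × Z r p′ q′
    forth-down  : ∀ {r p q p′} → Z (suc r) p q → p′ K.⊑ p → ∃[ q′ ] q′ L.⊑ q × Z r p′ q′
    back-down   : ∀ {r p q q′} → Z (suc r) p q → q′ L.⊑ q → ∃[ p′ ] p′ K.⊑ p × Z r p′ q′

  invariance : ∀ s {r p q} → depth s ≤ r → Z r p q → (p K⊩.⊩ s) ⇔ (q L⊩.⊩ rename f s)
  invariance (var x) _ z = mk⇔ (≡.subst T (atom z x)) (≡.subst T (≡.sym (atom z x)))
  invariance (s ∧ᵗ t) d z = mk⇔ (λ (h , k) → to I h , to J k) (λ (h , k) → from I h , from J k)
    where
    I = invariance s (ℕ.m⊔n≤o⇒m≤o _ _ d) z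
    J = invariance t (ℕ.m⊔n≤o⇒n≤o _ _ d) z
  invariance (s ∨ᵗ t) d z = mk⇔
    (λ h (¬s , ¬t) → h (¬s ∘ to I , ¬t ∘ to J)) (λ h (¬s , ¬t) → h (¬s ∘ from I , ¬t ∘ from J))
    where
    I = invariance s (ℕ.m⊔n≤o⇒m≤o _ _ d) z
    J = invariance t (ℕ.m⊔n≤o⇒n≤o _ _ d) z
  invariance (s ⇨ᵗ t) {suc r} (s≤s d) z = mk⇔
    (λ h q′ e → let p′ , e′ , z′ = back-up z e in to (J z′) ∘ h p′ e′ ∘ from (I z′))
    (λ h p′ e → let q′ , e′ , z′ = forth-up z e in from (J z′) ∘ h q′ e′ ∘ to (I z′))
    where
    I = λ {p} {q} → invariance s {r} {p} {q} (ℕ.m⊔n≤o⇒m≤o _ _ d)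
    J = λ {p} {q} → invariance t {r} {p} {q} (ℕ.m⊔n≤o⇒n≤o _ _ d)
  invariance (s -ᵗ t) {suc r} (s≤s d) z = mk⇔
    (λ h k → h λ p′ e → let q′ , e′ , z′ = forth-down z e in from (J z′) ∘ k q′ e′ ∘ to (I z′))
    (λ h k → h λ q′ e → let p′ , e′ , z′ = back-down z e in to (J z′) ∘ k p′ e′ ∘ from (I z′))
    where
    I = λ {p} {q} → invariance s {r} {p} {q} (ℕ.m⊔n≤o⇒m≤o _ _ d)
    J = λ {p} {q} → invariance t {r} {p} {q} (ℕ.m⊔n≤o⇒n≤o _ _ d)
  invariance 𝟘ᵗ _ _ = ⇔.refl
  invariance 𝟙ᵗ _ _ = ⇔.refl

open BoundedBisimulation using (invariance)

module _ {X Y : Set} (f : X → Y) (K : Kripke Y) where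
  open Kripke K

  reduct : Kripke X
  reduct = record
    { Point = Point ; _⊑_ = _⊑_ ; ⊑-refl = ⊑-refl ; ⊑-trans = ⊑-trans
    ; V = V ∘ f ; V-up = V-up ∘ f }

  ⊩-reduct : ∀ s {p} → Forcing._⊩_ reduct p s ⇔ Forcing._⊩_ K p (rename f s)
  ⊩-reduct s = invariance {Z = λ _ → _≡_} record
    { atom = λ { refl _ → refl }
    ; forth-up = λ { refl e → _ , e , refl } ; back-up = λ { refl e → _ , e , refl }
    ; forth-down = λ { refl e → _ , e , refl } ; back-down = λ { refl e → _ , e , refl }
    } s ℕ.≤-refl refl

  rename-isHomomorphism : IsHomomorphism (Alg reduct) (Alg K) (rename f)
  rename-isHomomorphism = record
    { cong = λ {s t} (e ⇋ e′) →
        (λ p → to (⊩-reduct t) ∘ e p ∘ from (⊩-reduct s))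
      ⇋ (λ p → to (⊩-reduct s) ∘ e′ p ∘ from (⊩-reduct t))
    ; ∧-homo = λ _ _ → ≈-refl ; ∨-homo = λ _ _ → ≈-refl
    ; ⇨-homo = λ _ _ → ≈-refl ; -‿homo = λ _ _ → ≈-refl
    ; 𝟘-homo = ≈-refl ; 𝟙-homo = ≈-refl }
    where open Equality (Alg K)

  rename-injective : Injective (Algebra._≈_ (Alg reduct)) (Algebra._≈_ (Alg K)) (rename f)
  rename-injective {s} {t} (e ⇋ e′) =
      (λ p → from (⊩-reduct t) ∘ e p ∘ to (⊩-reduct s))
    ⇋ (λ p → from (⊩-reduct s) ∘ e′ p ∘ to (⊩-reduct t))

-- Fences

-- Variables 0, 1, 2 stand for x, y, z; models without x number y, z as 0, 1.

data End : Set where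
  left right : End

-- Each ray is an infinite zigzag starting at `up e 0` and numbered from its end: `down e i` lies
-- below `up e i` and `up e (suc i)`. The two rays are not connected.
data Rays : Set where
  up down : End → ℕ → Rays

data _⊑ʳ_ : Rel Rays 0ℓ where
  ⊑-refl : ∀ {p} → p ⊑ʳ p
  near   : ∀ {e i} → down e i ⊑ʳ up e i
  far    : ∀ {e i} → down e i ⊑ʳ up e (suc i)

rays : Kripke (Fin 3)
rays = record
  { Point = Rays ; _⊑_ = _⊑ʳ_ ; ⊑-refl = ⊑-refl
  ; ⊑-trans = λ { ⊑-refl e → e ; near ⊑-refl → near ; far ⊑-refl → far }
  ; V = V ; V-up = V-up }
  where
  V : Fin 3 → Rays → Bool
  V 0F (up left _)         = true
  V 0F (down left _)       = true
  V 1F (up left zero)      = true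
  V 2F (up left _)         = true
  V 2F (down left _)       = true
  -- The set of z omits `down right 0` along with `up right 0`, since it must be closed upwards.
  V 2F (up right (suc _))  = true
  V 2F (down right (suc _)) = true
  V _  _                   = false

  V-up : ∀ x {p q} → p ⊑ʳ q → T (V x p) → T (V x q)
  V-up _  ⊑-refl h = h
  V-up 0F (near {left}) _ = tt
  V-up 0F (far {left})  _ = tt
  V-up 2F (near {left}) _ = tt
  V-up 2F (far {left})  _ = tt
  V-up 2F (near {right} {suc _}) _ = tt
  V-up 2F (far {right})  _ = tt

-- Recording the distances `i` to the left end and `j` to the right end lets a point be compared
-- with either ray by pattern matching.
data Fence (n : ℕ) : Set where
  up   : ∀ i j → n ≡ i + j → Fence n
  down : ∀ i j → n ≡ suc (i + j) → Fence n

data _⊑ᶠ_ {n} : Rel (Fence n) 0ℓ where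
  ⊑-refl : ∀ {p} → p ⊑ᶠ p
  before : ∀ {i j e e′} → down i j e ⊑ᶠ up i (suc j) e′
  after  : ∀ {i j e e′} → down i j e ⊑ᶠ up (suc i) j e′

fence : ℕ → Kripke (Fin 2)
fence n = record
  { Point = Fence n ; _⊑_ = _⊑ᶠ_ ; ⊑-refl = ⊑-refl
  ; ⊑-trans = λ { ⊑-refl e → e ; before ⊑-refl → before ; after ⊑-refl → after }
  ; V = V ; V-up = V-up }
  where
  V : Fin 2 → Fence n → Bool
  V 0F (up zero _ _)         = true
  V 1F (up _ (suc _) _)      = true
  V 1F (down _ (suc _) _)    = true
  V _  _                     = false

  V-up : ∀ x {p q} → p ⊑ᶠ q → T (V x p) → T (V x q)
  V-up _  ⊑-refl h = h
  V-up 1F before _ = tt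
  V-up 1F (after {j = suc _}) _ = tt

-- Each move changes either distance by at most one, so a point farther than `r` from the right end
-- sees, within `r` moves, only what the left ray shows; the other side is symmetric. Points in the
-- middle may match both rays.
data Match (n r : ℕ) : REL (Fence n) Rays 0ℓ where
  up-left    : ∀ {i j e} → r < j → Match n r (up i j e) (up left i)
  down-left  : ∀ {i j e} → r < j → Match n r (down i j e) (down left i)
  up-right   : ∀ {i j e} → r < i → Match n r (up i j e) (up right j)
  down-right : ∀ {i j e} → r < i → Match n r (down i j e) (down right j)

rays₂ : Kripke (Fin 2)
rays₂ = reduct suc rays

fence-rays : ∀ n → BoundedBisimulation suc (fence n) rays (Match n)
fence-rays n = record
  { atom = atom ; forth-up = forth-up ; back-up = back-up
  ; forth-down = forth-down ; back-down = back-down }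
  where
  weaken< : ∀ {r j} → suc r < j → r < j
  weaken< = ℕ.<-trans (ℕ.n<1+n _)

  shift : ∀ {i j} → n ≡ suc (i + j) → n ≡ i + suc j
  shift e = ≡.trans e (≡.sym (ℕ.+-suc _ _))

  unshift : ∀ {i j} → n ≡ i + suc j → n ≡ suc (i + j)
  unshift e = ≡.trans e (ℕ.+-suc _ _)

  atom : ∀ {r p q} → Match n r p q → ∀ x → Kripke.V (fence n) x p ≡ Kripke.V rays (suc x) q
  -- Strictness of the bound keeps the point off the other end even at `r = 0`, so y and z take the
  -- values they have on the ray.
  atom (up-left {zero} (s≤s _)) 0F = refl
  atom (up-left {suc _} (s≤s _)) 0F = refl
  atom (up-left (s≤s _)) 1F = refl
  atom (down-left (s≤s _)) 0F = refl
  atom (down-left (s≤s _)) 1F = refl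
  atom (up-right (s≤s _)) 0F = refl
  atom (up-right {j = zero} (s≤s _)) 1F = refl
  atom (up-right {j = suc _} (s≤s _)) 1F = refl
  atom (down-right (s≤s _)) 0F = refl
  atom (down-right {j = zero} (s≤s _)) 1F = refl
  atom (down-right {j = suc _} (s≤s _)) 1F = refl

  weaken-Match : ∀ {r p q} → Match n (suc r) p q → Match n r p q
  weaken-Match (up-left h) = up-left (weaken< h)
  weaken-Match (down-left h) = down-left (weaken< h)
  weaken-Match (up-right h) = up-right (weaken< h)
  weaken-Match (down-right h) = down-right (weaken< h)

  forth-up : ∀ {r p q p′} → Match n (suc r) p q → p ⊑ᶠ p′ → ∃[ q′ ] q ⊑ʳ q′ × Match n r p′ q′
  forth-up m ⊑-refl = _ , ⊑-refl , weaken-Match m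
  forth-up (down-left h) before = _ , near , up-left (ℕ.m<n⇒m<1+n (weaken< h))
  forth-up (down-left h) after = _ , far , up-left (weaken< h)
  -- The right ray is numbered from the other end, so `before` corresponds to `far` and `after` to
  -- `near`.
  forth-up (down-right h) before = _ , far , up-right (weaken< h)
  forth-up (down-right h) after = _ , near , up-right (ℕ.m<n⇒m<1+n (weaken< h))

  back-up : ∀ {r p q q′} → Match n (suc r) p q → q ⊑ʳ q′ → ∃[ p′ ] p ⊑ᶠ p′ × Match n r p′ q′
  back-up m ⊑-refl = _ , ⊑-refl , weaken-Match m
  back-up (down-left {e = e} h) near = _ , before {e′ = shift e} , up-left (ℕ.m<n⇒m<1+n (weaken< h))
  back-up (down-left {e = e} h) far = _ , after {e′ = e} , up-left (weaken< h)
  back-up (down-right {e = e} h) near = _ , after {e′ = e} , up-right (ℕ.m<n⇒m<1+n (weaken< h))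
  back-up (down-right {e = e} h) far = _ , before {e′ = shift e} , up-right (weaken< h)

  forth-down : ∀ {r p q p′} → Match n (suc r) p q → p′ ⊑ᶠ p → ∃[ q′ ] q′ ⊑ʳ q × Match n r p′ q′
  forth-down m ⊑-refl = _ , ⊑-refl , weaken-Match m
  -- Here the distance to the end missing from the ray shrinks by one, which the drop of the bound
  -- from `suc r` to `r` pays for.
  forth-down (up-left (s≤s h)) before = _ , near , down-left h
  forth-down (up-left h) after = _ , far , down-left (weaken< h)
  forth-down (up-right h) before = _ , far , down-right (weaken< h)
  forth-down (up-right (s≤s h)) after = _ , near , down-right h

  back-down : ∀ {r p q q′} → Match n (suc r) p q → q′ ⊑ʳ q → ∃[ p′ ] p′ ⊑ᶠ p × Match n r p′ q′
  back-down m ⊑-refl = _ , ⊑-refl , weaken-Match m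
  back-down (up-left {e = e} (s≤s h)) near = _ , before {e = unshift e} , down-left h
  back-down (up-left {e = e} h) far = _ , after {e = e} , down-left (weaken< h)
  back-down (up-right {e = e} (s≤s h)) near = _ , after {e = e} , down-right h
  back-down (up-right {e = e} h) far = _ , before {e = unshift e} , down-right (weaken< h)

fence-rays₂ : ∀ {r p q} (s : Term (Fin 2)) → depth s ≤ r → Match n r p q →
              Forcing._⊩_ (fence n) p s ⇔ Forcing._⊩_ rays₂ q s
fence-rays₂ s d m = ⇔.trans (invariance (fence-rays _) s d m) (⇔.sym (⊩-reduct suc rays s))

-- A point within `r` of both ends would give `n ≤ r + r`, or `n ≤ suc (r + r)` if it is a lower
-- point; the hypothesis excludes both.
match-ray : ∀ {r} → suc (r + r) < n → (p : Fence n) → ∃[ q ] Match n r p q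
match-ray {r = r} h (up i j e) with r ℕ.<? i | r ℕ.<? j
... | yes r<i | _ = _ , up-right r<i
... | no _ | yes r<j = _ , up-left r<j
... | no r≮i | no r≮j = contradiction (ℕ.+-mono-≤ (ℕ.≮⇒≥ r≮i) (ℕ.≮⇒≥ r≮j))
  (ℕ.<⇒≱ (≡.subst (r + r <_) e (ℕ.<-trans (ℕ.n<1+n _) h)))
match-ray {r = r} h (down i j e) with r ℕ.<? i | r ℕ.<? j
... | yes r<i | _ = _ , down-right r<i
... | no _ | yes r<j = _ , down-left r<j
... | no r≮i | no r≮j = contradiction (s≤s (ℕ.+-mono-≤ (ℕ.≮⇒≥ r≮i) (ℕ.≮⇒≥ r≮j)))
  (ℕ.<⇒≱ (≡.subst (suc (r + r) <_) e h))

-- The bound on the length depends on `q`. That suffices for refuting an equation, where one point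
-- is followed into all long fences.
match-fence : ∀ r (q : Rays) → ∃[ m ] ∀ {n} → m ≤ n → ∃[ p ] Match n r p q
match-fence r (up left i) = i + suc r , λ h →
  let k , e = ℕ.m≤n⇒∃[o]m+o≡n h in
  up i (suc r + k) (≡.trans (≡.sym e) (ℕ.+-assoc i (suc r) k)) , up-left (ℕ.m≤m+n (suc r) k)
match-fence r (down left i) = suc (i + suc r) , λ h →
  let k , e = ℕ.m≤n⇒∃[o]m+o≡n h in
  down i (suc r + k) (≡.trans (≡.sym e) (≡.cong suc (ℕ.+-assoc i (suc r) k)))
  , down-left (ℕ.m≤m+n (suc r) k)
match-fence r (up right j) = suc r + j , λ {n} h →
  let k = n ∸ (suc r + j) ; e = ℕ.m∸n+n≡m h in
  up (k + suc r) j (≡.sym (≡.trans (ℕ.+-assoc k (suc r) j) e)) , up-right (ℕ.m≤n+m (suc r) k)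
match-fence r (down right j) = suc (suc r + j) , λ {n} h →
  let k = n ∸ suc (suc r + j) ; e = ℕ.m∸n+n≡m h in
  down (k + suc r) j
    (≡.sym (≡.trans (≡.cong suc (ℕ.+-assoc k (suc r) j)) (≡.trans (≡.sym (ℕ.+-suc k _)) e)))
  , down-right (ℕ.m≤n+m (suc r) k)

-- Complemented interpolants

infix 4 _≤ᵗ_

_≤ᵗ_ : Term X → Term X → Equation X
s ≤ᵗ t = s , s ∧ᵗ t

-- In a Kripke model `□ s` says that `s` holds after every move up followed by a move down.
□ : Term X → Term X
□ s = (𝟙ᵗ -ᵗ s) ⇨ᵗ 𝟘ᵗ

□^ : ℕ → Term X → Term X
□^ zero    s = s
□^ (suc k) s = □ (□^ k s)

y≤□^z : ℕ → Equation (Fin 2)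
y≤□^z k = var 0F ≤ᵗ □^ k (var 1F)

-- The join of x and `1 - x` is always 1 by residuation, so the third equation makes x complemented.
complementedInterpolant : List (Equation (Fin 3))
complementedInterpolant =
  (var 1F ≤ᵗ var 0F) ∷ (var 0F ≤ᵗ var 2F) ∷ (var 0F ∧ᵗ (𝟙ᵗ -ᵗ var 0F) ≤ᵗ 𝟘ᵗ) ∷ []

module _ {A : Algebra c ℓ} (dha : IsDoubleHeytingAlgebra A) where
  open DoubleHeyting dha

  -- If x lies below `□^ k z`, then `1 - □^ k z` lies below `1 - x`, which is disjoint from x;
  -- residuation turns this into x below `□^ (suc k) z`.
  interpolant⇒□^ : ∀ {ρ : Fin 3 → Algebra.Carrier A} → All (Holds A ρ) complementedInterpolant →
                   ∀ k → Holds A (ρ ∘ suc) (y≤□^z k)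
  interpolant⇒□^ {ρ} (y≤x ∷ x≤z ∷ x∧¬x≤0 ∷ []) k = trans y≤x (x≤□^z k)
    where
    open Algebra A renaming (_≤_ to _⊑_)
    x≤□^z : ∀ k → ρ 0F ⊑ eval A (ρ ∘ suc) (□^ k (var 1F))
    x≤□^z zero    = x≤z
    x≤□^z (suc k) = transpose-⇨ (trans
      (∧-greatest (x∧y≤x _ _) (trans (x∧y≤y _ _) ∼-antitone)) x∧¬x≤0)
      where
      ∼-antitone : 𝟙 - eval A (ρ ∘ suc) (□^ k (var 1F)) ⊑ 𝟙 - ρ 0F
      ∼-antitone = residual-intro (trans (residual-elim (reflexive Eq.refl))
        (∨-least (trans (x≤□^z k) (x≤x∨y _ _)) (y≤x∨y _ _)))

-- Transfer between rays and long fences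

module _ (c ℓ : Level) where

  R : Algebra c ℓ
  R = Lifted c ℓ (Alg rays)

  -- A copy of the subalgebra of `R` generated by y and z, on terms that do not mention x.
  R₂ : Algebra c ℓ
  R₂ = Lifted c ℓ (Alg rays₂)

  F : ℕ → Algebra c ℓ
  F n = Lifted c ℓ (Alg (fence n))

  R-isDHA : IsDoubleHeytingAlgebra R
  R-isDHA = Lifted-isDoubleHeytingAlgebra (Alg-isDoubleHeytingAlgebra rays)

  R₂-isDHA : IsDoubleHeytingAlgebra R₂
  R₂-isDHA = Lifted-isDoubleHeytingAlgebra (Alg-isDoubleHeytingAlgebra rays₂)

  F-isDHA : ∀ n → IsDoubleHeytingAlgebra (F n)
  F-isDHA n = Lifted-isDoubleHeytingAlgebra (Alg-isDoubleHeytingAlgebra (fence n))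

  generators : X → Lift c (Term X)
  generators = ↑ ∘ var

  R₂↪R : Embeds R₂ R
  R₂↪R = ↑ ∘ rename suc ∘ lower , record
    { cong = λ e → ↑ (cong (lower e))
    ; ∧-homo = λ s t → ↑ (∧-homo (lower s) (lower t)) ; ∨-homo = λ s t → ↑ (∨-homo (lower s) (lower t))
    ; ⇨-homo = λ s t → ↑ (⇨-homo (lower s) (lower t)) ; -‿homo = λ s t → ↑ (-‿homo (lower s) (lower t))
    ; 𝟘-homo = ↑ 𝟘-homo ; 𝟙-homo = ↑ 𝟙-homo }
    , λ e → ↑ (rename-injective suc rays (lower e))
    where open IsHomomorphism (rename-isHomomorphism suc rays)

  R-interpolant : All (Holds R generators) complementedInterpolant
  R-interpolant = ↑ (⊴⇒≤ y≤x) ∷ ↑ (⊴⇒≤ x≤z) ∷ ↑ (⊴⇒≤ disjoint) ∷ []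
    where
    open Forcing rays using (_⊴_; ⊴⇒≤)
    y≤x : var 1F ⊴ var 0F
    y≤x (up left _) _ = tt

    x≤z : var 0F ⊴ var 2F
    x≤z (up left _)   _ = tt
    x≤z (down left _) _ = tt

    -- Whatever lies below a point of the left ray is on the left ray, so `𝟙ᵗ -ᵗ var 0F` is not
    -- forced there.
    disjoint : (var 0F ∧ᵗ (𝟙ᵗ -ᵗ var 0F)) ⊴ 𝟘ᵗ
    disjoint (up left _)   (_ , h) = h λ { _ ⊑-refl _ → tt ; _ near _ → tt ; _ far _ → tt }
    disjoint (down left _) (_ , h) = h λ { _ ⊑-refl _ → tt }

  -- Each `□` allows one move to the right, from `up i (suc k)` down and up again. Starting at the
  -- left end, where y holds, `n` such moves reach the right end, where z fails.
  F⊭y≤□^z : ∀ n → ¬ Holds (F n) generators (y≤□^z n)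
  F⊭y≤□^z n (↑ (e ⇋ _)) = ¬□^z n (proj₂ (e (up 0 n refl) tt))
    where
    open Forcing (fence n) using (_⊩_; ⊩-up)
    ¬□^z : ∀ k {i} {e : n ≡ i + k} → ¬ (up i k e ⊩ lower (eval (F n) generators (□^ k (var 1F))))
    ¬□^z zero    h = h
    ¬□^z (suc k) {i} {e} h = h (up i (suc k) e) ⊑-refl λ below → ¬□^z k {suc i} {e′}
      (⊩-up (lower (eval (F n) generators (□^ k (var 1F)))) (after {e = e′})
        (below (down i k e′) before tt))
      where e′ = ≡.trans e (ℕ.+-suc i k)

  -- `R₂` and `F n` have the same carrier and operations and differ only in equality, so evaluation
  -- gives the same term in both.
  eval-fence : ∀ n {ρ ρ′ : X → Lift c (Term (Fin 2))} → (∀ x → ρ x ≡ ρ′ x) →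
               ∀ s → eval R₂ ρ s ≡ eval (F n) ρ′ s
  eval-fence n h s = eval-rel {A = R₂} {B = F n} {R = _≡_} record
    { ∧-rel = ≡.cong₂ _∧_ ; ∨-rel = ≡.cong₂ _∨_ ; ⇨-rel = ≡.cong₂ _⇨_ ; -‿rel = ≡.cong₂ _-_
    ; 𝟘-rel = refl ; 𝟙-rel = refl } h s
    where open Algebra R₂

  -- Both sides evaluate to terms `u` and `v` of depth at most `d`. In a fence longer than twice `d`
  -- plus one every point matches a ray point at bound `d`, so the equivalence of `u` and `v` on the
  -- rays carries over.
  eventually-holds : ∀ {ρ ρ′ : X → Lift c (Term (Fin 2))} → (∀ x → ρ x ≡ ρ′ x) → ∀ s t →
                     Holds R₂ ρ (s , t) → ∃[ m ] ∀ n → m ≤ n → Holds (F n) ρ′ (s , t)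
  eventually-holds {ρ = ρ} h s t (↑ (e ⇋ e′)) = suc (suc (d + d)) , λ n m≤n →
    ≡.subst₂ (Algebra._≈_ (F n)) (eval-fence n h s) (eval-fence n h t)
      (↑ ((λ p k → let q , m = match-ray m≤n p in from (J m) (e q (to (I m) k)))
         ⇋ (λ p k → let q , m = match-ray m≤n p in from (I m) (e′ q (to (J m) k)))))
    where
    u = lower (eval R₂ ρ s)
    v = lower (eval R₂ ρ t)
    d = depth u ⊔ depth v
    I = λ {n p q} → fence-rays₂ {n} {d} {p} {q} u (ℕ.m≤m⊔n _ _)
    J = λ {n p q} → fence-rays₂ {n} {d} {p} {q} v (ℕ.m≤n⊔m _ _)

  -- A refuting ray point persists in all long fences. As it cannot be exhibited, the argument is by
  -- contradiction: without such a bound `u` and `v` would agree at each point of the rays.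
  eventually-fails : ∀ {ρ ρ′ : X → Lift c (Term (Fin 2))} → (∀ x → ρ x ≡ ρ′ x) → ∀ s t →
                     ¬ Holds R₂ ρ (s , t) → ¬ ¬ (∃[ m ] ∀ n → m ≤ n → ¬ Holds (F n) ρ′ (s , t))
  eventually-fails {ρ = ρ} h s t ¬e ¬∃ = ¬e (↑ (
      (λ q k → ⊩-stable v λ ¬k → differ q λ e → ¬k (to e k))
    ⇋ (λ q k → ⊩-stable u λ ¬k → differ q λ e → ¬k (from e k))))
    where
    open Forcing rays₂ using (_⊩_; ⊩-stable)
    u = lower (eval R₂ ρ s)
    v = lower (eval R₂ ρ t)
    d = depth u ⊔ depth v
    I = λ {n p q} → fence-rays₂ {n} {d} {p} {q} u (ℕ.m≤m⊔n _ _)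
    J = λ {n p q} → fence-rays₂ {n} {d} {p} {q} v (ℕ.m≤n⊔m _ _)

    differ : ∀ q → ¬ ¬ ((q ⊩ u) ⇔ (q ⊩ v))
    differ q ¬agree = ¬∃ (proj₁ (match-fence d q) , λ n m≤n e →
      let p , m = proj₂ (match-fence d q) m≤n
          ↑ (f ⇋ f′) = ≡.subst₂ (Algebra._≈_ (F n)) (≡.sym (eval-fence n h s)) (≡.sym (eval-fence n h t)) e
      in ¬agree (mk⇔ (to (J m) ∘ f p ∘ from (I m)) (to (I m) ∘ f′ p ∘ from (J m))))

  eventually-all : {P : X → ℕ → Set p} (xs : List X) →
                   All (λ x → ∃[ m ] ∀ n → m ≤ n → P x n) xs →
                   ∃[ m ] ∀ n → m ≤ n → All (λ x → P x n) xs
  eventually-all []       []             = 0 , λ _ _ → []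
  eventually-all (x ∷ xs) ((m , h) ∷ hs) =
    let m′ , hs′ = eventually-all xs hs in
    m ⊔ m′ , λ n e → h n (ℕ.m⊔n≤o⇒m≤o m m′ e) ∷ hs′ n (ℕ.m⊔n≤o⇒n≤o m m′ e)

  -- A long fence satisfies `P`, yet it refutes the inequality whose exponent `k` is its own length.
  -- Interpolation and coherence both reduce to this.
  not-finitely-axiomatised : (P : List (Equation (Fin 2))) → All (Holds R₂ generators) P →
                             ¬ (∀ k → Entails c ℓ P (y≤□^z k))
  not-finitely-axiomatised P hP entails =
    let m , h = eventually-all P (All.map (λ {(s , t)} → eventually-holds (λ _ → refl) s t) hP) in
    F⊭y≤□^z m (entails m (F m) (F-isDHA m) generators (h m ℕ.≤-refl))

  R₂-holds : ∀ s t → Holds R (generators ∘ suc) (s , t) → Holds R₂ generators (s , t)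
  R₂-holds s t = let h , hom , inj = R₂↪R in
    from (holds-embedding hom inj (λ _ → Equality.≈-refl R) s t)

-- Right uniform deductive interpolation

holds-rename : (A : Algebra c ℓ) (f : X → Y) {ρ : Y → Algebra.Carrier A} {ρ′ : X → Algebra.Carrier A} →
               (∀ x → ρ (f x) ≡ ρ′ x) → ∀ ε → Holds A ρ (renameEq f ε) ⇔ Holds A ρ′ ε
holds-rename A f h (s , t) = holds-bind (λ x → ≈-reflexive (h x)) s t
  where open Equality A

all-holds-rename : (A : Algebra c ℓ) (f : X → Y) {ρ : Y → Algebra.Carrier A} {ρ′ : X → Algebra.Carrier A} →
                   (∀ x → ρ (f x) ≡ ρ′ x) → ∀ S → All (Holds A ρ) (map (renameEq f) S) ⇔ All (Holds A ρ′) S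
all-holds-rename A f h []      = mk⇔ (λ _ → []) (λ _ → [])
all-holds-rename A f h (ε ∷ S) = mk⇔
  (λ { (e ∷ es) → to (holds-rename A f h ε) e ∷ to (all-holds-rename A f h S) es })
  (λ { (e ∷ es) → from (holds-rename A f h ε) e ∷ from (all-holds-rename A f h S) es })

¬rightUniformDeductiveInterpolation : ∀ c ℓ → ¬ RightUniformDeductiveInterpolation c ℓ
¬rightUniformDeductiveInterpolation c ℓ rudi = not-finitely-axiomatised c ℓ P P-holds P-entails
  where
  S : List (Equation (Fin 1 ⊎ Fin 2))
  S = map (renameEq (splitAt 1)) complementedInterpolant

  P : List (Equation (Fin 2))
  P = proj₁ (rudi 1 2 S)

  S-holds : (A : Algebra c ℓ) {ρ : Fin 1 ⊎ (Fin 2 ⊎ Fin 0) → Algebra.Carrier A} {ρ′ : Fin 3 → Algebra.Carrier A} →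
            (∀ i → ρ (Sum.map₂ inj₁ (splitAt 1 i)) ≡ ρ′ i) →
            All (Holds A ρ) (map (renameEq (Sum.map₂ inj₁)) S) ⇔ All (Holds A ρ′) complementedInterpolant
  S-holds A h = ⇔.trans
    (all-holds-rename A (Sum.map₂ inj₁) (λ _ → refl) S) (all-holds-rename A (splitAt 1) h complementedInterpolant)

  y-holds : (A : Algebra c ℓ) {ρ : Fin 1 ⊎ (Fin 2 ⊎ Fin 0) → Algebra.Carrier A} → ∀ ε →
            Holds A ρ (renameEq inj₂ (renameEq inj₁ ε)) ⇔ Holds A (ρ ∘ inj₂ ∘ inj₁) ε
  y-holds A {ρ} ε = ⇔.trans
    (holds-rename A inj₂ {ρ} {ρ ∘ inj₂} (λ _ → refl) (renameEq inj₁ ε))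
    (holds-rename A inj₁ (λ _ → refl) ε)

  equivalent : ∀ (ε : Equation (Fin 2)) →
    Entails c ℓ (map (renameEq (Sum.map₂ inj₁)) S) (renameEq inj₂ (renameEq inj₁ ε))
    ⇔ Entails c ℓ (map (renameEq inj₁) P) (renameEq inj₁ ε)
  equivalent ε = proj₂ (rudi 1 2 S) 0 (renameEq inj₁ ε)

  -- Each equation of `P` follows from `P`, hence from `S`, hence holds in `R`, where the left ray
  -- interprets x. It mentions only y and z, so it descends to `R₂`.
  P-holds : All (Holds (R₂ c ℓ) (generators c ℓ)) P
  P-holds = All.tabulate λ {ε} ε∈P → R₂-holds c ℓ (proj₁ ε) (proj₂ ε)
    (to (y-holds (R c ℓ) ε)
      (from (equivalent ε) (λ A _ ρ hP → All.lookup hP (∈ˡ.∈-map⁺ (renameEq inj₁) ε∈P))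
        (R c ℓ) (R-isDHA c ℓ) ρ
        (from (S-holds (R c ℓ) {ρ} λ { 0F → refl ; (suc _) → refl }) (R-interpolant c ℓ))))
    where
    ρ : Fin 1 ⊎ (Fin 2 ⊎ Fin 0) → Lift c (Term (Fin 3))
    ρ = [ (λ _ → ↑ (var 0F)) , [ ↑ ∘ var ∘ suc , (λ ()) ]′ ]′

  P-entails : ∀ k → Entails c ℓ P (y≤□^z k)
  P-entails k A dha ρ hP = to (holds-rename A inj₁ (λ _ → refl) (y≤□^z k))
    (to (equivalent (y≤□^z k)) S-entails A dha [ ρ , (λ ()) ]′
      (from (all-holds-rename A inj₁ (λ _ → refl) P) hP))
    where
    S-entails : Entails c ℓ (map (renameEq (Sum.map₂ inj₁)) S) (renameEq inj₂ (renameEq inj₁ (y≤□^z k)))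
    S-entails B dhb σ hS = from (y-holds B (y≤□^z k))
      (interpolant⇒□^ dhb (to (S-holds B (λ _ → refl)) hS) k)

-- Coherence

-- Tietze transformation: the given presentation is rewritten in terms of the
-- generators g, using terms u expressing its n generators through g, and
-- terms w expressing g through them.
presentation-of-⟨⟩ : ∀ c′ ℓ′ (A : Algebra c ℓ) {m : ℕ} (g : Fin m → Algebra.Carrier A) →
  FinitelyPresented (⟨ A ⟩ g) →
  ∃[ P ] All (Holds A g) P × (∀ ε → Holds A g ε → Entails c′ ℓ′ P ε)
presentation-of-⟨⟩ c′ ℓ′ A {m} g (n , S , h , hom , inj , surj) =
  S[u] ++ g=w , All.++⁺ S[u]-holds g=w-holds , entails
  where
  open Algebra A
  open Equality A

  u : Fin n → Term (Fin m)
  u i = proj₁ (generated⇒term A (proj₂ (h (var i))))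

  w : Fin m → Term (Fin n)
  w j = proj₁ (surj (g j , gen j))

  S[u] g=w : List (Equation (Fin m))
  S[u] = map (λ (s , t) → bind u s , bind u t) S
  g=w  = tabulate λ j → bind u (w j) , var j

  u≈h : ∀ i → eval A g (u i) ≈ proj₁ (h (var i))
  u≈h i = proj₂ (generated⇒term A (proj₂ (h (var i))))

  h′ : Term (Fin n) → Carrier
  h′ = proj₁ ∘ h

  eval-h′ : ∀ s → eval A (h′ ∘ var) s ≈ h′ s
  eval-h′ (var i)  = ≈-refl
  eval-h′ (s ∧ᵗ t) = ≈-trans (∧-cong (eval-h′ s) (eval-h′ t)) (≈-sym (IsHomomorphism.∧-homo hom s t))
  eval-h′ (s ∨ᵗ t) = ≈-trans (∨-cong (eval-h′ s) (eval-h′ t)) (≈-sym (IsHomomorphism.∨-homo hom s t))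
  eval-h′ (s ⇨ᵗ t) = ≈-trans (⇨-cong (eval-h′ s) (eval-h′ t)) (≈-sym (IsHomomorphism.⇨-homo hom s t))
  eval-h′ (s -ᵗ t) = ≈-trans (-‿cong (eval-h′ s) (eval-h′ t)) (≈-sym (IsHomomorphism.-‿homo hom s t))
  eval-h′ 𝟘ᵗ       = ≈-sym (IsHomomorphism.𝟘-homo hom)
  eval-h′ 𝟙ᵗ       = ≈-sym (IsHomomorphism.𝟙-homo hom)

  eval-bind-u : ∀ s → eval A g (bind u s) ≈ h′ s
  eval-bind-u s = ≈-trans (≈-reflexive (eval-bind g u s))
    (≈-trans (eval-rel ≈-logical u≈h s) (eval-h′ s))

  h′-w : ∀ j → h′ (w j) ≈ g j
  h′-w j = proj₂ (surj (g j , gen j)) (Cg-incl ≃-refl)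

  h′-bind-w : ∀ s → h′ (bind w s) ≈ eval A g s
  h′-bind-w s = ≈-trans (≈-sym (eval-h′ (bind w s)))
    (≈-trans (≈-reflexive (eval-bind (h′ ∘ var) w s))
      (eval-rel ≈-logical (λ j → ≈-trans (eval-h′ (w j)) (h′-w j)) s))

  S[u]-holds : All (Holds A g) S[u]
  S[u]-holds = All.map⁺ (All.tabulate λ {(s , t)} ε∈S →
    ≈-trans (eval-bind-u s) (≈-trans (IsHomomorphism.cong hom (Cg-base ε∈S)) (≈-sym (eval-bind-u t))))

  g=w-holds : All (Holds A g) g=w
  g=w-holds = All.tabulate⁺ λ j → ≈-trans (eval-bind-u (w j)) (h′-w j)

  entails : ∀ ε → Holds A g ε → Entails c′ ℓ′ (S[u] ++ g=w) ε
  entails (s , t) e B dhb ρ hP =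
    -- The equality in the subalgebra becomes, by injectivity of `h`, a congruence between
    -- `bind w s` and `bind w t`. Evaluating it in `B` gives `s` and `t` back because `ρ` satisfies
    -- `g=w`.
    to (B.holds-bind w-sound s t)
      (Cg-sound dhb S-sound (inj (≈-trans (h′-bind-w s) (≈-trans e (≈-sym (h′-bind-w t))))))
    where
    module B = Equality B
    S-sound : All (Holds B (eval B ρ ∘ u)) S
    S-sound = All.map (λ {(s , t)} → to (B.holds-bind (λ _ → B.≈-refl) s t)) (All.map⁻ (All.++⁻ˡ S[u] hP))

    w-sound : ∀ j → Algebra._≈_ B (eval B (eval B ρ ∘ u) (w j)) (ρ j)
    w-sound j = B.≈-trans (B.≈-reflexive (≡.sym (B.eval-bind ρ u (w j)))) (All.tabulate⁻ (All.++⁻ʳ S[u] hP) j)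

-- The algebra presented by x, y, z and the interpolant equations has a subalgebra, generated by y
-- and z, that is not finitely presented: equations presenting it would hold in `R` through `A→R`
-- and entail all the inequalities.
¬coherent : ∀ c ℓ → ¬ Coherent c ℓ
¬coherent c ℓ coherent =
  let P , P-holds , entails = presentation-of-⟨⟩ c ℓ A g (coherent A A-isDHA A-presented g) in
  not-finitely-axiomatised c ℓ P
    (All.map (λ {(s , t)} e → R₂-holds c ℓ s t (holds-hom A→R (λ _ → Equality.≈-refl (R c ℓ)) s t e)) P-holds)
    (λ k → entails (y≤□^z k) (interpolant⇒□^ A-isDHA A-interpolant k))
  where
  A : Algebra c ℓ
  A = Lifted c ℓ (Free (Fin 3) / complementedInterpolant)

  A-isDHA : IsDoubleHeytingAlgebra A
  A-isDHA = Lifted-isDoubleHeytingAlgebra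
    (Quotient.isDoubleHeytingAlgebra (Free-isDoubleHeytingAlgebra (Fin 3)) complementedInterpolant)

  A-presented : FinitelyPresented A
  A-presented = 3 , complementedInterpolant , ↑ , ↑-isHomomorphism c ℓ _ , lower , λ s → lower s , ↑

  g : Fin 2 → Lift c (Term (Fin 3))
  g = ↑ ∘ var ∘ suc

  A-interpolant : All (Holds A (↑ ∘ var)) complementedInterpolant
  A-interpolant = ↑ (Cg-base (here refl)) ∷ ↑ (Cg-base (there (here refl)))
    ∷ ↑ (Cg-base (there (there (here refl)))) ∷ []

  A→R : IsHomomorphism A (R c ℓ) (eval (R c ℓ) (generators c ℓ) ∘ lower)
  A→R = record
    { cong = λ e → Cg-sound (R-isDHA c ℓ) (R-interpolant c ℓ) (lower e)
    ; ∧-homo = λ _ _ → ≈-refl ; ∨-homo = λ _ _ → ≈-refl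
    ; ⇨-homo = λ _ _ → ≈-refl ; -‿homo = λ _ _ → ≈-refl ; 𝟘-homo = ≈-refl ; 𝟙-homo = ≈-refl }
    where open Equality (R c ℓ)

-- Model completions

module Semantics (A : Algebra a ℓ) where
  open Algebra A
  open Equality A

  infix 4 _¬¬≈_
  _¬¬≈_ : Rel Carrier ℓ
  x ¬¬≈ y = ¬ ¬ (x ≈ y)

  ¬¬≈-refl : ∀ {x} → x ¬¬≈ x
  ¬¬≈-refl = contradiction ≈-refl

  ¬¬≈-sym : ∀ {x y} → x ¬¬≈ y → y ¬¬≈ x
  ¬¬≈-sym = ¬¬-map ≈-sym

  ¬¬≈-trans : ∀ {x y z} → x ¬¬≈ y → y ¬¬≈ z → x ¬¬≈ z
  ¬¬≈-trans p q = negated-stable (¬¬-map (λ e → ¬¬-map (≈-trans e) q) p)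

  holds-¬¬≈ : ∀ {x x′ y y′} → x ¬¬≈ x′ → y ¬¬≈ y′ → (x ¬¬≈ y) ⇔ (x′ ¬¬≈ y′)
  holds-¬¬≈ p q = mk⇔ (λ e → ¬¬≈-trans (¬¬≈-sym p) (¬¬≈-trans e q))
                      (λ e → ¬¬≈-trans p (¬¬≈-trans e (¬¬≈-sym q)))

  eval-bind-¬¬≈ : (ρ : Y → Carrier) (σ : X → Term Y) {ρ′ : X → Carrier} →
                  (∀ x → eval A ρ (σ x) ¬¬≈ ρ′ x) → ∀ s → eval A ρ (bind σ s) ¬¬≈ eval A ρ′ s
  eval-bind-¬¬≈ ρ σ h s =
    ≡.subst (_¬¬≈ _) (≡.sym (eval-bind ρ σ s)) (eval-rel ¬¬≈-logical h s)

  Satisfies-mapConst : {C : Set b} {D : Set c} (f : C → D) {κ : D → Carrier} {κ′ : C → Carrier} →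
    (∀ x → κ (f x) ¬¬≈ κ′ x) → ∀ {n} (φ : Formula C n) {ρ ρ′ : Fin n → Carrier} →
    (∀ i → ρ i ¬¬≈ ρ′ i) → Satisfies A κ ρ (mapConst f φ) ⇔ Satisfies A κ′ ρ′ φ
  Satisfies-mapConst f {κ} {κ′} hκ = go
    where
    go : ∀ {n} (φ : Formula _ n) {ρ ρ′ : Fin n → Carrier} →
         (∀ i → ρ i ¬¬≈ ρ′ i) → Satisfies A κ ρ (mapConst f φ) ⇔ Satisfies A κ′ ρ′ φ
    go (s ≐ t) {ρ} {ρ′} h = mk⇔ (λ e → ↑ (to iff (lower e))) (λ e → ↑ (from iff (lower e)))
      where
      eval-≈ = eval-bind-¬¬≈ [ κ , ρ ]′ (var ∘ Sum.map₁ f) {[ κ′ , ρ′ ]′} λ { (inj₁ x) → hκ x ; (inj₂ i) → h i }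
      iff = holds-¬¬≈ (eval-≈ s) (eval-≈ t)
    go ⊥̇ h = mk⇔ id id
    go (φ ⇒ ψ) h = mk⇔ (λ e → to (go ψ h) ∘ e ∘ from (go φ h)) (λ e → from (go ψ h) ∘ e ∘ to (go φ h))
    go (∀̇ φ) {ρ} {ρ′} h = mk⇔ (λ e x → to (go φ (h∷ x)) (e x)) (λ e x → from (go φ (h∷ x)) (e x))
      where
      h∷ : ∀ x i → (x Vector.∷ ρ) i ¬¬≈ (x Vector.∷ ρ′) i
      h∷ x zero    = ¬¬≈-refl
      h∷ x (suc i) = h i

  module _ {C : Set c} (κ : C → Carrier) where

    Satisfies-stable : (φ : Formula C n) {ρ : Fin n → Carrier} → Stable (Satisfies A κ ρ φ)
    Satisfies-stable (s ≐ t) h = ↑ (negated-stable (¬¬-map lower h))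
    Satisfies-stable ⊥̇       h = ↑ (h lower)
    Satisfies-stable (φ ⇒ ψ) h k = Satisfies-stable ψ (¬¬-map (λ f → f k) h)
    Satisfies-stable (∀̇ φ)   h x = Satisfies-stable φ (¬¬-map (λ f → f x) h)

    Satisfies-subst : ∀ {m n} (φ : Formula C n) (σ : Fin n → Term (C ⊎ Fin m))
      {ρ : Fin m → Carrier} {ρ′ : Fin n → Carrier} →
      (∀ i → eval A [ κ , ρ ]′ (σ i) ¬¬≈ ρ′ i) → Satisfies A κ ρ (subst σ φ) ⇔ Satisfies A κ ρ′ φ
    Satisfies-subst (s ≐ t) σ {ρ} {ρ′} h = mk⇔ (λ e → ↑ (to iff (lower e))) (λ e → ↑ (from iff (lower e)))
      where
      eval-≈ = eval-bind-¬¬≈ [ κ , ρ ]′ [ var ∘ inj₁ , σ ]′ {[ κ , ρ′ ]′}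
        λ { (inj₁ x) → ¬¬≈-refl ; (inj₂ i) → h i }
      iff = holds-¬¬≈ (eval-≈ s) (eval-≈ t)
    Satisfies-subst ⊥̇ σ h = mk⇔ id id
    Satisfies-subst (φ ⇒ ψ) σ h = mk⇔
      (λ e → to (Satisfies-subst ψ σ h) ∘ e ∘ from (Satisfies-subst φ σ h))
      (λ e → from (Satisfies-subst ψ σ h) ∘ e ∘ to (Satisfies-subst φ σ h))
    Satisfies-subst (∀̇ φ) σ {ρ} {ρ′} h = mk⇔
      (λ e x → to (Satisfies-subst φ (lift σ) (h∷ x)) (e x))
      (λ e x → from (Satisfies-subst φ (lift σ) (h∷ x)) (e x))
      where
      h∷ : ∀ x i → eval A [ κ , x Vector.∷ ρ ]′ (lift σ i) ¬¬≈ (x Vector.∷ ρ′) i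
      h∷ x zero    = ¬¬≈-refl
      h∷ x (suc i) = ¬¬≈-trans
        (eval-bind-¬¬≈ [ κ , x Vector.∷ ρ ]′ (var ∘ Sum.map₂ suc) {[ κ , ρ ]′}
          (λ { (inj₁ _) → ¬¬≈-refl ; (inj₂ _) → ¬¬≈-refl }) (σ i))
        (h i)

    Satisfies-[] : ∀ (φ : Formula C (suc n)) t {ρ x} → eval A [ κ , ρ ]′ t ¬¬≈ x →
                   Satisfies A κ ρ (φ [ t ]) ⇔ Satisfies A κ (x Vector.∷ ρ) φ
    Satisfies-[] φ t h = Satisfies-subst φ _ λ { zero → h ; (suc _) → ¬¬≈-refl }

-- This is compactness in syntactic form: a derivation uses finitely many axioms. Membership proofs
-- are kept in order to tell axioms of `T*` from diagram sentences.
axioms : {C : Set c} {T : Theory C p} {Γ : List (Formula C n)} {φ : Formula C n} →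
         T ∣ Γ ⊢ φ → List (∃ T)
axioms (axiom φ∈T)     = (_ , φ∈T) ∷ []
axioms (assume _)      = []
axioms (⇒-intro d)     = axioms d
axioms (⇒-elim d e)    = axioms d ++ axioms e
axioms (raa d)         = axioms d
axioms (∀-intro d)     = axioms d
axioms (∀-elim d _)    = axioms d
axioms (≐-refl _)      = []
axioms (≐-subst _ d e) = axioms d ++ axioms e

module _ (A : Algebra a ℓ) {C : Set c} (κ : C → Algebra.Carrier A) where
  open Algebra A using (Carrier)
  open Semantics A

  -- Only the axioms that occur in `d` are required to hold, so a model of a finite part of the
  -- diagram is enough.
  soundness : {T : Theory C p} {Γ : List (Formula C n)} {φ : Formula C n} (d : T ∣ Γ ⊢ φ) →
              All (λ (ψ , _) → Satisfies A κ (λ ()) ψ) (axioms d) →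
              ∀ ρ → All (Satisfies A κ ρ) Γ → Satisfies A κ ρ φ
  soundness (axiom {φ} _) (hT ∷ []) ρ hΓ = from (Satisfies-subst κ φ (λ ()) (λ ())) hT
  soundness (assume φ∈Γ) hT ρ hΓ = All.lookup hΓ φ∈Γ
  soundness (⇒-intro d) hT ρ hΓ h = soundness d hT ρ (h ∷ hΓ)
  soundness (⇒-elim d e) hT ρ hΓ =
    soundness d (All.++⁻ˡ (axioms d) hT) ρ hΓ (soundness e (All.++⁻ʳ (axioms d) hT) ρ hΓ)
  soundness (raa {φ} d) hT ρ hΓ =
    Satisfies-stable κ φ λ ¬h → lower (soundness d hT ρ ((λ h → contradiction h ¬h) ∷ hΓ))
  soundness (∀-intro d) hT ρ hΓ x = soundness d hT (x Vector.∷ ρ)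
    (All.map⁺ (All.map (λ {ψ} → from (Satisfies-subst κ ψ _ (λ _ → ¬¬≈-refl))) hΓ))
  soundness (∀-elim {φ} d t) hT ρ hΓ =
    from (Satisfies-[] κ φ t ¬¬≈-refl) (soundness d hT ρ hΓ (eval A [ κ , ρ ]′ t))
  soundness (≐-refl t) hT ρ hΓ = ↑ ¬¬≈-refl
  soundness (≐-subst φ {s} {t} d e) hT ρ hΓ =
    from (Satisfies-[] κ φ t (¬¬≈-sym (lower (soundness d (All.++⁻ˡ (axioms d) hT) ρ hΓ))))
      (to (Satisfies-[] κ φ s ¬¬≈-refl) (soundness e (All.++⁻ʳ (axioms d) hT) ρ hΓ))

Satisfies-Expand : {C : Set c} {T : Theory ⊥ p} (A : Algebra a ℓ) → Models A T →
                   (κ : C → Algebra.Carrier A) → ∀ {φ} → φ ∈ Expand C T → Satisfies A κ (λ ()) φ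
Satisfies-Expand A models κ (ψ , ψ∈T , refl) =
  from (Semantics.Satisfies-mapConst A ⊥-elim (λ ()) ψ (λ ())) (models ψ∈T)

Satisfies-embedding : {A : Algebra a ℓ} {B : Algebra b ℓ′} ((e , _) : Embeds A B) {C : Set c}
  {κ : C → Algebra.Carrier A} {φ : Formula C 0} → QuantifierFree φ → ∀ {ρ ρ′} →
  Satisfies A κ ρ φ ⇔ Satisfies B (e ∘ κ) ρ′ φ
Satisfies-embedding {A = A} {B} (e , hom , inj) {κ = κ} = go
  where
  open Equality B
  go : ∀ {φ} → QuantifierFree φ → ∀ {ρ ρ′} → Satisfies A κ ρ φ ⇔ Satisfies B (e ∘ κ) ρ′ φ
  go (s ≐ t) {ρ} {ρ′} = mk⇔ (λ h → ↑ (¬¬-map (to iff) (lower h))) (λ h → ↑ (¬¬-map (from iff) (lower h)))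
    where iff = holds-embedding hom inj {[ κ , ρ ]′} {[ e ∘ κ , ρ′ ]′} (λ { (inj₁ _) → ≈-refl ; (inj₂ ()) }) s t
  go ⊥̇ = mk⇔ (λ ()) (λ ())
  go (p ⇒ q) = mk⇔ (λ h → to (go q) ∘ h ∘ from (go p)) (λ h → from (go q) ∘ h ∘ to (go p))

-- First-order sentences about interpolants

infer : {C : Set c} → (X → C ⊎ Fin n) → List (Equation X) → Formula C n → Formula C n
infer f []            ψ = ψ
infer f ((s , t) ∷ S) ψ = (rename f s ≐ rename f t) ⇒ infer f S ψ

module _ (A : Algebra a ℓ) {C : Set c} (κ : C → Algebra.Carrier A) (ρ : Fin n → Algebra.Carrier A)
         (f : X → C ⊎ Fin n) (ρ′ : X → Algebra.Carrier A) (h : ∀ x → [ κ , ρ ]′ (f x) ≡ ρ′ x) where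

  Satisfies-≐ : ∀ s t → Satisfies A κ ρ (rename f s ≐ rename f t) ⇔ (¬ ¬ Holds A ρ′ (s , t))
  Satisfies-≐ s t = mk⇔ (λ e → ¬¬-map (to iff) (lower e)) (λ e → ↑ (¬¬-map (from iff) e))
    where iff = holds-rename A f {[ κ , ρ ]′} h (s , t)

  Satisfies-infer : ∀ S ψ → Satisfies A κ ρ (infer f S ψ) ⇔
                    (All (λ ε → ¬ ¬ Holds A ρ′ ε) S → Satisfies A κ ρ ψ)
  Satisfies-infer []            ψ = mk⇔ (λ k _ → k) (λ k → k [])
  Satisfies-infer ((s , t) ∷ S) ψ = mk⇔
    (λ { k (e ∷ es) → to (Satisfies-infer S ψ) (k (from (Satisfies-≐ s t) e)) es })
    (λ k e → from (Satisfies-infer S ψ) (λ es → k (to (Satisfies-≐ s t) e ∷ es)))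

¬¬-all : {P : X → Set p} {xs : List X} → All (λ x → ¬ ¬ P x) xs → ¬ ¬ All P xs
¬¬-all []         ¬h = ¬h []
¬¬-all (hx ∷ hxs) ¬h = hx λ x → ¬¬-all hxs λ xs → ¬h (x ∷ xs)

∅ : {X : Set a} → Fin 0 → X
∅ ()

module _ (c ℓ : Level) where
  open Algebra (R₂ c ℓ) using (Carrier)

  -- An equivalence, since `⇒` is contravariant on the left. An atom is eventually true or
  -- eventually false along the fences according to its truth in `R₂`; this case distinction is
  -- classical, whence the double negation.
  eventually-agrees : ∀ {φ : Sentence Carrier} → QuantifierFree φ → ∀ {ρ ρ′} →
    ¬ ¬ (∃[ m ] ∀ n → m ≤ n → Satisfies (R₂ c ℓ) id ρ φ ⇔ Satisfies (F c ℓ n) id ρ′ φ)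
  eventually-agrees (s ≐ t) {ρ} {ρ′} ¬∃ = ¬¬-excluded-middle λ
    { (yes e) → let m , h = eventually-holds c ℓ same s t e in
      ¬∃ (m , λ n m≤n → mk⇔ (λ _ → ↑ (contradiction (h n m≤n))) (λ _ → ↑ (contradiction e)))
    ; (no ¬e) → eventually-fails c ℓ same s t ¬e λ (m , h) →
      ¬∃ (m , λ n m≤n → mk⇔ (λ e → contradiction ¬e (lower e)) (λ e → contradiction (h n m≤n) (lower e))) }
    where
    same : ∀ x → [ id , ρ ]′ x ≡ [ id , ρ′ ]′ x
    same (inj₁ _) = refl
  eventually-agrees ⊥̇ ¬∃ = ¬∃ (0 , λ _ _ → mk⇔ id id)
  eventually-agrees (p ⇒ q) ¬∃ =
    eventually-agrees p λ (m , h) → eventually-agrees q λ (m′ , h′) →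
    ¬∃ (m ⊔ m′ , λ n e →
      let I = h n (ℕ.m⊔n≤o⇒m≤o m m′ e) ; J = h′ n (ℕ.m⊔n≤o⇒n≤o m m′ e) in
      mk⇔ (λ k → to J ∘ k ∘ from I) (λ k → from J ∘ k ∘ to I))

  parameters : Fin 3 → Carrier ⊎ Fin 1
  parameters zero    = inj₂ zero
  parameters (suc i) = inj₁ (generators c ℓ i)

  no-interpolant : Sentence Carrier
  no-interpolant = ∀̇ infer parameters complementedInterpolant ⊥̇

  Satisfies-no-interpolant : (A : Algebra a ℓ′) (κ : Carrier → Algebra.Carrier A) → ∀ ρ →
    Satisfies A κ ρ no-interpolant ⇔
    (∀ x → ¬ All (λ ε → ¬ ¬ Holds A (x Vector.∷ (κ ∘ generators c ℓ)) ε) complementedInterpolant)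
  Satisfies-no-interpolant A κ ρ = mk⇔ (λ k x h → lower (to (body x) (k x) h))
                                         (λ k x → from (body x) (⊥-elim ∘ k x))
    where
    body = λ x → Satisfies-infer A κ (x Vector.∷ ρ) parameters (x Vector.∷ (κ ∘ generators c ℓ))
      (λ { zero → refl ; (suc _) → refl }) complementedInterpolant ⊥̇

  -- Models of `T*` are known only through the sentences they satisfy, so `interpolant⇒□^` is cast
  -- as a sentence of `Th`. The quantifiers bind z, y, x in that order, making x index 0.
  interpolant-sentence : ℕ → Sentence ⊥
  interpolant-sentence k = ∀̇ ∀̇ ∀̇ infer inj₂ complementedInterpolant
    (rename (inj₂ ∘ suc) (proj₁ (y≤□^z k)) ≐ rename (inj₂ ∘ suc) (proj₂ (y≤□^z k)))

  ⊨interpolant-sentence : (A : Algebra a ℓ′) → ∀ k → A ⊨ interpolant-sentence k ⇔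
    (∀ ρ → All (λ ε → ¬ ¬ Holds A ρ ε) complementedInterpolant → ¬ ¬ Holds A (ρ ∘ suc) (y≤□^z k))
  ⊨interpolant-sentence A k = mk⇔
    (λ h ρ hyps → to (conclusion ρ _ λ { 0F → refl ; 1F → refl })
      (to (hypotheses ρ _ λ { 0F → refl ; 1F → refl ; 2F → refl }) (h (ρ 2F) (ρ 1F) (ρ 0F)) hyps))
    (λ h z y x → from (hypotheses (x Vector.∷ (y Vector.∷ (z Vector.∷ λ ()))) _ (λ _ → refl))
      (λ hyps → from (conclusion (x Vector.∷ (y Vector.∷ (z Vector.∷ λ ()))) _ (λ _ → refl)) (h _ hyps)))
    where
    conclusion = λ ρ ρ′ h → Satisfies-≐ A ⊥-elim ρ′ (inj₂ ∘ suc) (ρ ∘ suc) h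
                              (proj₁ (y≤□^z k)) (proj₂ (y≤□^z k))
    hypotheses = λ ρ ρ′ h → Satisfies-infer A ⊥-elim ρ′ inj₂ ρ h complementedInterpolant
      (rename (inj₂ ∘ suc) (proj₁ (y≤□^z k)) ≐ rename (inj₂ ∘ suc) (proj₂ (y≤□^z k)))

  interpolant-sentence∈Th : ∀ k → interpolant-sentence k ∈ Th c ℓ
  interpolant-sentence∈Th k A dha = from (⊨interpolant-sentence A k) λ ρ h →
    ¬¬-map (λ h → interpolant⇒□^ dha h k) (¬¬-all h)

  module _ {T* : Theory ⊥ p} (mc : IsModelCompletion c ℓ (Th c ℓ) T*) where
    open IsModelCompletion mc

    ThR₂ : Theory Carrier _
    ThR₂ = Expand Carrier T* ∪ Diagram (R₂ c ℓ)

    -- A model of `T*` containing `R` also contains `R₂` and so satisfies its diagram, but the left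
    -- ray from `R` is an interpolant in it.
    ¬⊢no-interpolant : ¬ (ThR₂ ⊢ no-interpolant)
    ¬⊢no-interpolant d =
      let N , N⊨T* , R↪N@(i , i-hom , _) = embeds (R c ℓ) (λ φ∈T → φ∈T (R c ℓ) (R-isDHA c ℓ))
          κ = i ∘ proj₁ (R₂↪R c ℓ)
          sound : ∀ {φ} → φ ∈ ThR₂ → Satisfies N κ (λ ()) φ
          sound = λ { (inj₁ φ∈) → Satisfies-Expand N N⊨T* κ φ∈
                    ; (inj₂ (qf , h)) → to (Satisfies-embedding R↪N qf)
                        (to (Satisfies-embedding (R₂↪R c ℓ) qf {ρ′ = λ ()}) h) }
      in to (Satisfies-no-interpolant N κ ∅)
        (soundness N κ d (All.universal (sound ∘ proj₂) (axioms d)) ∅ [])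
        (i (generators c ℓ 0F))
        (All.map (λ {(s , t)} h → contradiction (holds-hom i-hom
          (λ { zero → Equality.≈-refl N ; (suc _) → Equality.≈-refl N }) s t h)) (R-interpolant c ℓ))

    -- A derivation uses a finite part of the diagram, which holds in `F m` for large `m`, hence in
    -- a model `N` of `T*` containing `F m`. An interpolant in `N` would give y below `□^ m z` in
    -- `N`, and so in `F m`.
    ¬⊢¬no-interpolant : ¬ (ThR₂ ⊢ ¬̇ no-interpolant)
    ¬⊢¬no-interpolant d = ¬¬-all (All.universal transfers (axioms d)) λ hs →
      let m , h = eventually-all c ℓ (axioms d) hs
          N , N⊨T* , F↪N@(i , i-hom , i-inj) = embeds (F c ℓ m) (λ φ∈T → φ∈T (F c ℓ m) (F-isDHA c ℓ m))
          satisfies = soundness N i d (All.map (λ f → f N N⊨T* F↪N) (h m ℕ.≤-refl)) ∅ []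
      in lower (satisfies (from (Satisfies-no-interpolant N i ∅) λ x interpolant →
        to (⊨interpolant-sentence N m)
          (N⊨T* (extends {interpolant-sentence m} (interpolant-sentence∈Th m))) _ interpolant
          (F⊭y≤□^z c ℓ m ∘ from (holds-embedding i-hom i-inj (λ _ → Equality.≈-refl N)
            (proj₁ (y≤□^z m)) (proj₂ (y≤□^z m))))))
      where
      -- The model is quantified over because it is obtained from `embeds` only once the length `n`
      -- is fixed.
      Transfers : ∃ ThR₂ → ℕ → Set _
      Transfers (φ , _) n = ∀ (N : Algebra c ℓ) → Models N T* → ((e , _) : Embeds (F c ℓ n) N) →
                            Satisfies N e (λ ()) φ

      transfers : ∀ φ → ¬ ¬ (∃[ m ] ∀ n → m ≤ n → Transfers φ n)
      transfers (φ , inj₁ φ∈) ¬∃ = ¬∃ (0 , λ n _ N N⊨T* (e , _) → Satisfies-Expand N N⊨T* e φ∈)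
      transfers (φ , inj₂ (qf , h)) = ¬¬-map
        (λ (m , agrees) → m , λ n m≤n N _ i → to (Satisfies-embedding i qf) (to (agrees n m≤n) h))
        (eventually-agrees qf {ρ′ = λ ()})

¬hasModelCompletion : ∀ c ℓ p → ¬ HasModelCompletion c ℓ p
¬hasModelCompletion c ℓ p (T* , mc) =
  [ ¬⊢no-interpolant c ℓ mc , ¬⊢¬no-interpolant c ℓ mc ]′ (decides (no-interpolant c ℓ))
  where
  decides = proj₂ (IsModelCompletion.complete mc (R₂ c ℓ) (λ φ∈T → φ∈T (R₂ c ℓ) (R₂-isDHA c ℓ)))

corollary5p7 : ∀ (c ℓ p : Level) →
    (¬ Coherent c ℓ) × (¬ RightUniformDeductiveInterpolation c ℓ) × (¬ HasModelCompletion c ℓ p)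
corollary5p7 c ℓ p = ¬coherent c ℓ , ¬rightUniformDeductiveInterpolation c ℓ , ¬hasModelCompletion c ℓ p
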